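{- Let $n$ be a positive integer and consider a front-yard/back-yard hash table that can hold up to $n$ items, whose front yard consists of $m$ bins, where $h = n/m$. Let $h$ and $j$ be parameters with $h \le n^{1/4}/\sqrt{\log n}$ and $j \le \sqrt{h}$, and let each front-yard bin have capacity $h + j\sqrt{h+1} + 1$. When an item $x$ is inserted, it is hashed uniformly at random into a bin $H(x)$; if bin $H(x)$ has room, $x$ is placed in that bin, and if bin $H(x)$ is full, $x$ is placed in the backyard. Items are never moved after insertion (until deleted). Then, over the course of any sequence of $\mathrm{poly}(m)$ insertions and deletions during which the table never contains more than $n$ items, at every moment the number of items in the backyard is $O\!\left(n/2^{\Omega(j^2)} + n^{3/4}\sqrt{\log n}\right)$ with probability $1 - 1/\mathrm{poly}(n)$.
   Context: Items are "balls" and front-yard slots groups are "bins". The hash function $H$ maps each item independently and uniformly at random to one of the $m$ bins, and the sequence of insertions/deletions is fixed in advance (independent of the hash values). A deleted item frees its slot in whichever part of the table it occupied. "With probability $1-1/\mathrm{poly}(n)$" means for any constant $c$ the probability is at least $1-n^{ -c}$ for suitable constants in the $O/\Omega$ notation.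
   Formalization: The parameter j is restricted to nonnegative rational numbers rather than arbitrary nonnegative real numbers. -}

module Defs where

open import Data.Nat using (ℕ; zero; suc; _+_; _*_; _∸_; _^_; _≤_; _<_; _<ᵇ_)
open import Data.Nat.DivMod using (_/_)
open import Data.Nat.Logarithm using (⌊log₂_⌋)
open import Data.Bool using (Bool; true; false; if_then_else_; _∧_; _∨_; not)
open import Data.Fin using (Fin; _≟_)
open import Data.Fin.Base using () renaming (zero to fz; suc to fs)
open import Data.List using (List; []; _∷_; map; concatMap)
open import Data.List.Base using (allFin)
open import Data.Vec using (Vec; lookup) renaming ([] to []ᵛ; _∷_ to _∷ᵛ_)
open import Data.Product using (_×_; ∃-syntax)
open import Data.Unit using (⊤)
open import Relation.Binary.PropositionalEquality using (_≡_)
open import Relation.Nullary.Decidable using (⌊_⌋)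

countFin : ∀ {U} → (Fin U → Bool) → ℕ
countFin {zero}  f = 0
countFin {suc U} f = (if f fz then 1 else 0) + countFin (λ i → f (fs i))

countL : ∀ {A : Set} → (A → Bool) → List A → ℕ
countL f []       = 0
countL f (x ∷ xs) = (if f x then 1 else 0) + countL f xs

allVecs : (m U : ℕ) → List (Vec (Fin m) U)
allVecs m zero    = []ᵛ ∷ []
allVecs m (suc U) = concatMap (λ b → map (b ∷ᵛ_) (allVecs m U)) (allFin m)

_÷_ : ℕ → ℕ → ℕ
a ÷ zero  = 0
a ÷ suc b = a / suc b

data Loc : Set where
  absent front back : Loc

isFront isBack : Loc → Bool
isFront front = true
isFront _     = false
isBack back = true
isBack _    = false

data Op (U : ℕ) : Set where
  ins : Fin U → Op U
  del : Fin U → Op U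

State : ℕ → Set
State U = Fin U → Loc

emptyState : ∀ {U} → State U
emptyState _ = absent

update : ∀ {U} → State U → Fin U → Loc → State U
update s x l i = if ⌊ i ≟ x ⌋ then l else s i

load : ∀ {U m} → Vec (Fin m) U → State U → Fin m → ℕ
load H s b = countFin (λ i → isFront (s i) ∧ ⌊ lookup H i ≟ b ⌋)

step : ∀ {U m} → ℕ → Vec (Fin m) U → State U → Op U → State U
step cap H s (ins x) = update s x (if load H s (lookup H x) <ᵇ cap then front else back)
step cap H s (del x) = update s x absent

backyard : ∀ {U} → State U → ℕ
backyard s = countFin (λ i → isBack (s i))

backyardTrace : ∀ {U m} → ℕ → Vec (Fin m) U → State U → List (Op U) → List ℕ
backyardTrace cap H s []         = backyard s ∷ []
backyardTrace cap H s (o ∷ ops) = backyard s ∷ backyardTrace cap H (step cap H s o) ops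

-- Well-formed sequence (fixed in advance, independent of H): only absent items are
-- inserted, only present items are deleted, and the table never holds more than n items.
-- P = set of currently present items.
setB : ∀ {U} → (Fin U → Bool) → Fin U → Bool → (Fin U → Bool)
setB P x v i = if ⌊ i ≟ x ⌋ then v else P i

WellFormed : ∀ {U} → ℕ → (Fin U → Bool) → List (Op U) → Set
WellFormed n P []            = ⊤
WellFormed n P (ins x ∷ ops) = (P x ≡ false) × (suc (countFin P) ≤ n) × WellFormed n (setB P x true) ops
WellFormed n P (del x ∷ ops) = (P x ≡ true) × WellFormed n (setB P x false) ops

-- Parameters.  h = n/m, j = p/q (q ≠ 0), L = ⌊log₂ n⌋.

-- cap = ⌊h + j √(h+1)⌋ + 1 , characterised exactly: cap = c + 1 where c is the
-- largest natural with c ≤ n/m + (p/q) √((n+m)/m), i.e.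
-- (c m ∸ n)² q² ≤ p² m (n+m) < ((c+1) m ∸ n)² q².
IsCapacity : (n m p q cap : ℕ) → Set
IsCapacity n m p q cap = ∃[ c ] (cap ≡ suc c
  × ((c * m ∸ n) ^ 2 * q ^ 2 ≤ p ^ 2 * m * (n + m))
  × (p ^ 2 * m * (n + m) < ((suc c) * m ∸ n) ^ 2 * q ^ 2))

-- The bound  B ≤ C (n / 2^e + n^{3/4} √L)  with e = ⌊j²/d⌋ (i.e. 2^{Ω(j²)} with
-- Ω-constant 1/d), written without roots:  (B·2^e ∸ C·n)⁴ ≤ C⁴ 2^{4e} n³ L².
violates : (C d n p q B : ℕ) → Bool
violates C d n p q B =
  let e = (p ^ 2) ÷ (q ^ 2 * d)
      L = ⌊log₂ n ⌋
  in C ^ 4 * 2 ^ (4 * e) * n ^ 3 * L ^ 2 <ᵇ (B * 2 ^ e ∸ C * n) ^ 4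

anyB : List Bool → Bool
anyB []       = false
anyB (b ∷ bs) = b ∨ anyB bs

bad : ∀ {U m} → (C d n p q cap : ℕ) → List (Op U) → Vec (Fin m) U → Bool
bad C d n p q cap ops H = anyB (map (violates C d n p q) (backyardTrace cap H emptyState ops))

-- number of bad hash functions among all m ^ U (uniform H ⇔ counting)
badCount : (C d n p q cap m U : ℕ) → List (Op U) → ℕ
badCount C d n p q cap m U ops = countL (bad C d n p q cap ops) (allVecs m U)

{-# OPTIONS --safe #-}
-- If Q x is the set of items present when x was last inserted, then x can sit in the back yard only if
-- at least cap items of Q x share its bin. The number of such x is a sum over the bins b of an increasing
-- function of the set R_b of items hashed to b; the bins being negatively associated, the moment generating
-- function of the sum is at most the product of those of single bins, where R_b contains each item
-- independently with probability 1/m. For one bin, writing h for a bound on n/m and k = 4h,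
--   (1 + 1/k)^X ≤ 1 + (1/k) Σ_{x ∈ P ∩ R} (1 + 1/k)^|P ∩ R| (1 + 1/r)^(|Q x ∩ R| − cap),
-- and the expectation of each summand factors over the items. With r of order √h / j the Chernoff factor is
-- 2^(−Ω(j²)), so Markov's inequality bounds the back yard by O(n / 2^Ω(j²) + h log n) at each fixed time, and
-- h log n ≤ n^(3/4) √(log n). A union bound over the moments of time finishes the proof.
module Submission where

open import Defs
open import Data.Bool using (Bool; true; false; if_then_else_; _∧_; _∨_; T)
open import Data.Fin using (Fin; zero; suc; _≟_)
open import Data.List using (List; []; _∷_; _++_; map; concatMap; tabulate; length)
open import Data.Nat using (ℕ; zero; suc; _+_; _*_; _∸_; _^_; _≤_; _<_; z≤n; s≤s; NonZero; _≤ᵇ_; _<ᵇ_; >-nonZero; ≢-nonZero)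
import Data.Nat as Nat
open import Data.Nat.DivMod using (_/_; _%_; m/n*n≤m; m≡m%n+[m/n]*n; m%n<n; m≥n⇒m/n>0)
open import Data.Nat.Logarithm using (⌊log₂_⌋; ⌊log₂⌋-mono-≤; ⌊log₂[2^n]⌋≡n)
open import Data.Nat.Properties hiding (_≟_)
open import Data.Nat.Tactic.RingSolver using (solve-∀)
open import Data.Product using (_×_; _,_; ∃-syntax)
open import Data.Unit using (tt)
open import Data.Vec using (Vec; []; _∷_; lookup)
import Data.Vec as Vec
open import Data.Vec.Properties using (lookup-map)
open import Function using (_∘_; it)
open import Relation.Binary.PropositionalEquality using (_≡_; refl; sym; trans; cong; cong₂; subst; _≗_)
open import Relation.Nullary using (¬_; yes; no; contradiction)
open import Relation.Nullary.Decidable using (⌊_⌋)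

-- Powers of natural numbers

-- The state of the table depends on the hash values in a tangled way, since whether an insertion
-- overflows depends on all earlier outcomes. The sets `P` of present items and `Q x`, however, are
-- determined by the operations alone. The analysis therefore never follows the state: it bounds the
-- overflow of a fixed family of sets, which dominates the back yard. The choice of `k` is a
-- compromise. The factor (1 + 1/k)^|P ∩ R| has an exponent of mean at most `h`, so 1/k must be of
-- order 1/h to keep its expectation bounded; `k = 4 * h` gives (1 + 2/(mk))^n ≤ 2. The price is
-- that forcing a failure probability n^(-c) costs a deviation of order k log n, the additive term h
-- log n. All inequalities between reals are stated in ℕ with denominators multiplied out, and
-- probabilities are counts of hash functions, so a ratio (1 + 1/N)^a appears as the pair
-- `(N + 1) ^ a` and `N ^ a` on opposite sides.

^-distribʳ-* : ∀ x y a → (x * y) ^ a ≡ x ^ a * y ^ a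
^-distribʳ-* x y zero    = refl
^-distribʳ-* x y (suc a) rewrite ^-distribʳ-* x y a = swap x y (x ^ a) (y ^ a)
  where
  swap : ∀ x y u v → x * y * (u * v) ≡ x * u * (y * v)
  swap = solve-∀

^-cancelʳ-≤ : ∀ x y a .{{_ : NonZero a}} → x ^ a ≤ y ^ a → x ≤ y
^-cancelʳ-≤ x y a le with x ≤? y
... | yes x≤y = x≤y
... | no  x≰y = contradiction le (<⇒≱ (^-monoˡ-< a (≰⇒> x≰y)))

-- (1 + t/N)^a ≤ 1 / (1 − ta/N).
^-ratio-≤ : ∀ t a b N → t * a + b ≤ N → (N + t) ^ a * b ≤ N ^ a * N
^-ratio-≤ t zero b N h = *-monoʳ-≤ 1 (≤-trans (m≤n+m b (t * 0)) h)
^-ratio-≤ t (suc a) b N h = begin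
  (N + t) * (N + t) ^ a * b      ≡⟨ e₁ (N + t) ((N + t) ^ a) b ⟩
  -- As b ≤ N, one factor (N + t)/N is at most (b + t)/b. Keeping `b` general lets the induction
  -- continue with `b + t`, and the product telescopes.
  (N + t) ^ a * ((N + t) * b)    ≤⟨ *-monoʳ-≤ ((N + t) ^ a) one-factor ⟩
  (N + t) ^ a * (N * (b + t))    ≡⟨ e₂ ((N + t) ^ a) N (b + t) ⟩
  N * ((N + t) ^ a * (b + t))    ≤⟨ *-monoʳ-≤ N (^-ratio-≤ t a (b + t) N h′) ⟩
  N * (N ^ a * N)                ≡⟨ *-assoc N (N ^ a) N ⟨
  N * N ^ a * N                  ∎
  where
  open ≤-Reasoning
  e₁ : ∀ x y z → x * y * z ≡ y * (x * z)
  e₁ = solve-∀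
  e₂ : ∀ x y z → x * (y * z) ≡ y * (x * z)
  e₂ = solve-∀
  e₃ : ∀ t a b → t * a + (b + t) ≡ t * suc a + b
  e₃ = solve-∀
  e₄ : ∀ N t b → N * b + N * t ≡ N * (b + t)
  e₄ = solve-∀
  h′ : t * a + (b + t) ≤ N
  h′ = subst (_≤ N) (sym (e₃ t a b)) h
  one-factor : (N + t) * b ≤ N * (b + t)
  one-factor = begin
    (N + t) * b     ≡⟨ *-distribʳ-+ b N t ⟩
    N * b + t * b   ≡⟨ cong (N * b +_) (*-comm t b) ⟩
    N * b + b * t   ≤⟨ +-monoʳ-≤ (N * b) (*-monoˡ-≤ t (m+n≤o⇒n≤o (t * suc a) h)) ⟩
    N * b + N * t   ≡⟨ e₄ N t b ⟩
    N * (b + t)     ∎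

^-ratio-≤2 : ∀ t a N .{{_ : NonZero N}} → 2 * (t * a) ≤ N → (N + t) ^ a ≤ 2 * N ^ a
^-ratio-≤2 t a N h = *-cancelʳ-≤ _ _ N (begin
  (N + t) ^ a * N         ≤⟨ *-monoʳ-≤ ((N + t) ^ a) N≤2b ⟩
  (N + t) ^ a * (2 * b)   ≡⟨ e₁ ((N + t) ^ a) b ⟩
  2 * ((N + t) ^ a * b)   ≤⟨ *-monoʳ-≤ 2 (^-ratio-≤ t a b N (≤-reflexive split)) ⟩
  2 * (N ^ a * N)         ≡⟨ *-assoc 2 (N ^ a) N ⟨
  2 * N ^ a * N           ∎)
  where
  open ≤-Reasoning
  b = N ∸ t * a
  split : t * a + b ≡ N
  split = m+[n∸m]≡n (≤-trans (m≤m+n (t * a) _) h)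
  e₁ : ∀ x b → x * (2 * b) ≡ 2 * (x * b)
  e₁ = solve-∀
  e₂ : ∀ x b → 2 * (x + b) ≡ 2 * x + 2 * b
  e₂ = solve-∀
  e₃ : ∀ x → 2 * x ≡ x + x
  e₃ = solve-∀
  N≤2b : N ≤ 2 * b
  N≤2b = +-cancelˡ-≤ N N (2 * b) (begin
    N + N              ≡⟨ e₃ N ⟨
    2 * N              ≡⟨ cong (2 *_) (sym split) ⟩
    2 * (t * a + b)    ≡⟨ e₂ (t * a) b ⟩
    2 * (t * a) + 2 * b ≤⟨ +-monoˡ-≤ (2 * b) h ⟩
    N + 2 * b          ∎)

bernoulli : ∀ N b → (N + b) * N ^ b ≤ N * (N + 1) ^ b
bernoulli N zero = ≤-reflexive (cong (_* 1) (+-identityʳ N))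
bernoulli N (suc b) = begin
  (N + suc b) * (N * N ^ b)       ≡⟨ e₁ N b (N ^ b) ⟩
  ((N + b) * N + N) * N ^ b       ≤⟨ *-monoˡ-≤ (N ^ b) (+-monoʳ-≤ ((N + b) * N) (m≤m+n N b)) ⟩
  ((N + b) * N + (N + b)) * N ^ b ≡⟨ e₂ (N + b) N (N ^ b) ⟩
  (N + 1) * ((N + b) * N ^ b)     ≤⟨ *-monoʳ-≤ (N + 1) (bernoulli N b) ⟩
  (N + 1) * (N * (N + 1) ^ b)     ≡⟨ e₃ (N + 1) N ((N + 1) ^ b) ⟩
  N * ((N + 1) * (N + 1) ^ b)     ∎
  where
  open ≤-Reasoning
  e₁ : ∀ N b x → (N + suc b) * (N * x) ≡ ((N + b) * N + N) * x
  e₁ = solve-∀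
  e₂ : ∀ y N x → (y * N + y) * x ≡ (N + 1) * (y * x)
  e₂ = solve-∀
  e₃ : ∀ x y z → x * (y * z) ≡ y * (x * z)
  e₃ = solve-∀

2*N^N≤[N+1]^N : ∀ N .{{_ : NonZero N}} → 2 * N ^ N ≤ (N + 1) ^ N
2*N^N≤[N+1]^N N = *-cancelˡ-≤ N (begin
  N * (2 * N ^ N)    ≡⟨ e₁ N (N ^ N) ⟩
  (N + N) * N ^ N    ≤⟨ bernoulli N N ⟩
  N * (N + 1) ^ N    ∎)
  where
  open ≤-Reasoning
  e₁ : ∀ N x → N * (2 * x) ≡ (N + N) * x
  e₁ = solve-∀

-- The exponent `b` contains `e` blocks of length `a`, each gaining a factor 2; on the remainder
-- `x ≤ y` suffices.
doubling : ∀ x y a b e → x ≤ y → 2 * x ^ a ≤ y ^ a → a * e ≤ b → x ^ b * 2 ^ e ≤ y ^ b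
doubling x y a b e x≤y h ae≤b = begin
  x ^ b * 2 ^ e                    ≡⟨ cong (λ t → x ^ t * 2 ^ e) (sym split) ⟩
  x ^ (a * e + c) * 2 ^ e          ≡⟨ cong (_* 2 ^ e) (^-distribˡ-+-* x (a * e) c) ⟩
  x ^ (a * e) * x ^ c * 2 ^ e      ≡⟨ cong (λ t → t * x ^ c * 2 ^ e) (sym (^-*-assoc x a e)) ⟩
  (x ^ a) ^ e * x ^ c * 2 ^ e      ≡⟨ e₁ ((x ^ a) ^ e) (x ^ c) (2 ^ e) ⟩
  2 ^ e * (x ^ a) ^ e * x ^ c      ≡⟨ cong (_* x ^ c) (sym (^-distribʳ-* 2 (x ^ a) e)) ⟩
  (2 * x ^ a) ^ e * x ^ c          ≤⟨ *-mono-≤ (^-monoˡ-≤ e h) (^-monoˡ-≤ c x≤y) ⟩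
  (y ^ a) ^ e * y ^ c              ≡⟨ cong (_* y ^ c) (^-*-assoc y a e) ⟩
  y ^ (a * e) * y ^ c              ≡⟨ sym (^-distribˡ-+-* y (a * e) c) ⟩
  y ^ (a * e + c)                  ≡⟨ cong (y ^_) split ⟩
  y ^ b                            ∎
  where
  open ≤-Reasoning
  c = b ∸ a * e
  split : a * e + c ≡ b
  split = m+[n∸m]≡n ae≤b
  e₁ : ∀ u v w → u * v * w ≡ w * u * v
  e₁ = solve-∀

shorten : ∀ x y a b u v .{{_ : NonZero x}} → x ≤ y → a ≤ b →
  y ^ b * u ≤ x ^ b * v → y ^ a * u ≤ x ^ a * v
shorten x y a b u v x≤y a≤b h = *-cancelʳ-≤ _ _ (x ^ c) {{m^n≢0 x c}} (begin
  y ^ a * u * x ^ c     ≤⟨ *-monoʳ-≤ (y ^ a * u) (^-monoˡ-≤ c x≤y) ⟩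
  y ^ a * u * y ^ c     ≡⟨ e₁ (y ^ a) u (y ^ c) ⟩
  y ^ a * y ^ c * u     ≡⟨ cong (_* u) (join y) ⟩
  y ^ b * u             ≤⟨ h ⟩
  x ^ b * v             ≡⟨ cong (_* v) (sym (join x)) ⟩
  x ^ a * x ^ c * v     ≡⟨ e₁ (x ^ a) v (x ^ c) ⟨
  x ^ a * v * x ^ c     ∎)
  where
  open ≤-Reasoning
  c = b ∸ a
  join : ∀ z → z ^ a * z ^ c ≡ z ^ b
  join z = trans (sym (^-distribˡ-+-* z a c)) (cong (z ^_) (m+[n∸m]≡n a≤b))
  e₁ : ∀ u v w → u * v * w ≡ u * w * v
  e₁ = solve-∀

-- In real terms: (1 + 1/(mr))^n ≤ (r/s)^h, r² / (s (r+1)) is at most 2^(e/h), and (1 + 1/r)^Δ ≥ 4^e.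
chernoff : ∀ m n w s e h Δ → 1 ≤ m → 1 ≤ w → 2 * w ≡ suc s → n ≤ m * h → h ≤ w * w * e →
  suc s * (2 * e) ≤ Δ →
  (m * suc s + 1) ^ n * suc s ^ (h + Δ) * 2 ^ e ≤ (m * suc s) ^ n * (suc s + 1) ^ (h + Δ)
chernoff m@(suc _) n w@(suc w′) s@(suc _) e h Δ _ _ r≡ n≤mh h≤ Δ≥ = *-cancelʳ-≤ _ _ K {{K≢0}} (begin
  (N + 1) ^ n * r ^ (h + Δ) * 2 ^ e * K
    ≡⟨ cong (λ t → (N + 1) ^ n * t * 2 ^ e * K) (^-distribˡ-+-* r h Δ) ⟩
  (N + 1) ^ n * (r ^ h * r ^ Δ) * 2 ^ e * (2 ^ e * s ^ h)
    ≡⟨ e₁ ((N + 1) ^ n) (r ^ h) (r ^ Δ) (2 ^ e) (s ^ h) ⟩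
  (N + 1) ^ n * s ^ h * (r ^ h * (r ^ Δ * (2 ^ e * 2 ^ e)))
    ≤⟨ *-mono-≤ mean (*-monoʳ-≤ (r ^ h) gain) ⟩
  N ^ n * r ^ h * (r ^ h * (r + 1) ^ Δ)
    ≡⟨ e₂ (N ^ n) (r ^ h) ((r + 1) ^ Δ) ⟩
  r ^ h * r ^ h * (N ^ n * (r + 1) ^ Δ)
    ≤⟨ *-monoˡ-≤ (N ^ n * (r + 1) ^ Δ) loss ⟩
  s ^ h * (r + 1) ^ h * 2 ^ e * (N ^ n * (r + 1) ^ Δ)
    ≡⟨ e₃ (s ^ h) ((r + 1) ^ h) (2 ^ e) (N ^ n) ((r + 1) ^ Δ) ⟩
  N ^ n * ((r + 1) ^ h * (r + 1) ^ Δ) * K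
    ≡⟨ cong (λ t → N ^ n * t * K) (sym (^-distribˡ-+-* (r + 1) h Δ)) ⟩
  N ^ n * (r + 1) ^ (h + Δ) * K ∎)
  where
  open ≤-Reasoning
  r = suc s
  N = m * r
  N′ = s * (r + 1)
  K = 2 ^ e * s ^ h
  K≢0 : NonZero K
  K≢0 = m*n≢0 (2 ^ e) (s ^ h) {{m^n≢0 2 e}} {{m^n≢0 s h}}
  e₁ : ∀ a b c d f → a * (b * c) * d * (d * f) ≡ a * f * (b * (c * (d * d)))
  e₁ = solve-∀
  e₂ : ∀ a b c → a * b * (b * c) ≡ b * b * (a * c)
  e₂ = solve-∀
  e₃ : ∀ a b c d f → a * b * c * (d * f) ≡ d * (b * f) * (c * a)
  e₃ = solve-∀
  e₄ : ∀ m x s → m * (x * s) ≡ x * (m * s)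
  e₄ = solve-∀
  e₅ : ∀ m s → 1 * m + m * s ≡ m * suc s
  e₅ = solve-∀
  e₆ : ∀ s → suc s * suc s ≡ s * (suc s + 1) + 1
  e₆ = solve-∀
  -- A block of `m` items has mean load one and costs (1 + 1/(mr))^m ≤ r/(r - 1); `h` such blocks
  -- cover the `n` items.
  perBin : (N + 1) ^ m * s ≤ N ^ m * r
  perBin = *-cancelˡ-≤ m (begin
    m * ((N + 1) ^ m * s)   ≡⟨ e₄ m ((N + 1) ^ m) s ⟩
    (N + 1) ^ m * (m * s)   ≤⟨ ^-ratio-≤ 1 m (m * s) N (≤-reflexive (e₅ m s)) ⟩
    N ^ m * (m * r)         ≡⟨ e₄ m (N ^ m) r ⟨
    m * (N ^ m * r)         ∎)
  mean : (N + 1) ^ n * s ^ h ≤ N ^ n * r ^ h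
  mean = shorten N (N + 1) n (m * h) (s ^ h) (r ^ h) (m≤m+n N 1) n≤mh (begin
    (N + 1) ^ (m * h) * s ^ h   ≡⟨ cong (_* s ^ h) (sym (^-*-assoc (N + 1) m h)) ⟩
    ((N + 1) ^ m) ^ h * s ^ h   ≡⟨ sym (^-distribʳ-* ((N + 1) ^ m) s h) ⟩
    ((N + 1) ^ m * s) ^ h       ≤⟨ ^-monoˡ-≤ h perBin ⟩
    (N ^ m * r) ^ h             ≡⟨ ^-distribʳ-* (N ^ m) r h ⟩
    (N ^ m) ^ h * r ^ h         ≡⟨ cong (_* r ^ h) (^-*-assoc N m h) ⟩
    N ^ (m * h) * r ^ h         ∎)
  gain : r ^ Δ * (2 ^ e * 2 ^ e) ≤ (r + 1) ^ Δ
  gain = subst (λ t → r ^ Δ * t ≤ (r + 1) ^ Δ)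
    (trans (cong (2 ^_) (cong (e +_) (+-identityʳ e))) (^-distribˡ-+-* 2 e e))
    (doubling r (r + 1) r Δ (2 * e) (m≤m+n r 1) (2*N^N≤[N+1]^N r) Δ≥)
  -- `N′` is r² - 1 with r = 2w, so (1 + 1/N′)^(w²) ≤ 2, and h ≤ w² e bounds the second-order loss
  -- (r²/N′)^h by 2^e. Against the gain 4^e this leaves 2^e.
  2ww≤N′ : 2 * (1 * (w * w)) ≤ N′
  2ww≤N′ = +-cancelʳ-≤ 1 _ _ (begin
    2 * (1 * (w * w)) + 1        ≤⟨ +-monoʳ-≤ (2 * (1 * (w * w))) (s≤s z≤n) ⟩
    2 * (1 * (w * w)) + 2 * (w * w) ≡⟨ e₇ w ⟩
    2 * w * (2 * w)              ≡⟨ cong₂ _*_ r≡ r≡ ⟩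
    r * r                        ≡⟨ e₆ s ⟩
    N′ + 1                       ∎)
    where
    e₇ : ∀ w → 2 * (1 * (w * w)) + 2 * (w * w) ≡ 2 * w * (2 * w)
    e₇ = solve-∀
  loss : r ^ h * r ^ h ≤ s ^ h * (r + 1) ^ h * 2 ^ e
  loss = begin
    r ^ h * r ^ h               ≡⟨ sym (^-distribʳ-* r r h) ⟩
    (r * r) ^ h                 ≡⟨ cong (_^ h) (e₆ s) ⟩
    (N′ + 1) ^ h                ≡⟨ *-identityʳ _ ⟨
    (N′ + 1) ^ h * 1            ≤⟨ shorten N′ (N′ + 1) h (w * w * e) 1 (2 ^ e) (m≤m+n N′ 1) h≤ (begin
      (N′ + 1) ^ (w * w * e) * 1   ≡⟨ *-identityʳ _ ⟩
      (N′ + 1) ^ (w * w * e)       ≡⟨ sym (^-*-assoc (N′ + 1) (w * w) e) ⟩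
      ((N′ + 1) ^ (w * w)) ^ e     ≤⟨ ^-monoˡ-≤ e (^-ratio-≤2 1 (w * w) N′ 2ww≤N′) ⟩
      (2 * N′ ^ (w * w)) ^ e       ≡⟨ ^-distribʳ-* 2 (N′ ^ (w * w)) e ⟩
      2 ^ e * (N′ ^ (w * w)) ^ e   ≡⟨ *-comm (2 ^ e) _ ⟩
      (N′ ^ (w * w)) ^ e * 2 ^ e   ≡⟨ cong (_* 2 ^ e) (^-*-assoc N′ (w * w) e) ⟩
      N′ ^ (w * w * e) * 2 ^ e     ∎) ⟩
    N′ ^ h * 2 ^ e              ≡⟨ cong (_* 2 ^ e) (^-distribʳ-* s (r + 1) h) ⟩
    s ^ h * (r + 1) ^ h * 2 ^ e ∎
chernoff m n (suc w) zero e h Δ _ _ r≡ _ _ _ = contradiction (trans (sym (e₁ w)) r≡) λ ()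
  where
  e₁ : ∀ w → 2 * suc w ≡ suc (suc (w + w))
  e₁ = solve-∀

-- (1 + y/z)^m ≤ (1 + 1/k)^T for z = m k E and T E ≥ 2 y, obtained by comparing (k E)-th powers:
-- (1 + y/z)^z ≤ 4^y and (1 + 1/k)^k ≥ 2.
budget : ∀ m k E y T .{{_ : NonZero m}} .{{_ : NonZero k}} .{{_ : NonZero E}} → 2 * y ≤ T * E →
  (m * (k * E) + y) ^ m * k ^ T ≤ (k + 1) ^ T * (m * (k * E)) ^ m
budget m k E y T h = ^-cancelʳ-≤ _ _ w (begin
  ((z + y) ^ m * k ^ T) ^ w              ≡⟨ ^-distribʳ-* ((z + y) ^ m) (k ^ T) w ⟩
  ((z + y) ^ m) ^ w * (k ^ T) ^ w        ≡⟨ cong₂ _*_ (^-*-assoc (z + y) m w) (^-*-assoc k T w) ⟩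
  (z + y) ^ z * k ^ (T * w)              ≤⟨ *-monoˡ-≤ (k ^ (T * w)) exp-bound ⟩
  2 ^ (2 * y) * z ^ z * k ^ (T * w)      ≡⟨ e₁ (2 ^ (2 * y)) (z ^ z) (k ^ (T * w)) ⟩
  z ^ z * (k ^ (T * w) * 2 ^ (2 * y))    ≤⟨ *-monoʳ-≤ (z ^ z) (*-monoʳ-≤ (k ^ (T * w)) (^-monoʳ-≤ 2 h)) ⟩
  z ^ z * (k ^ (T * w) * 2 ^ (T * E))    ≤⟨ *-monoʳ-≤ (z ^ z) (doubling k (k + 1) k (T * w) (T * E)
                                              (m≤m+n k 1) (2*N^N≤[N+1]^N k) (≤-reflexive (e₂ k T E))) ⟩
  z ^ z * (k + 1) ^ (T * w)              ≡⟨ cong₂ _*_ (^-*-assoc z m w) (^-*-assoc (k + 1) T w) ⟨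
  (z ^ m) ^ w * ((k + 1) ^ T) ^ w        ≡⟨ *-comm ((z ^ m) ^ w) _ ⟩
  ((k + 1) ^ T) ^ w * (z ^ m) ^ w        ≡⟨ sym (^-distribʳ-* ((k + 1) ^ T) (z ^ m) w) ⟩
  ((k + 1) ^ T * z ^ m) ^ w              ∎)
  where
  open ≤-Reasoning
  w = k * E
  z = m * w
  instance
    w≢0 : NonZero w
    w≢0 = m*n≢0 k E
    z≢0 : NonZero z
    z≢0 = m*n≢0 m w
    2z≢0 : NonZero (2 * z)
    2z≢0 = m*n≢0 2 z
  e₁ : ∀ a b c → a * b * c ≡ b * (c * a)
  e₁ = solve-∀
  e₂ : ∀ k T E → k * (T * E) ≡ T * (k * E)
  e₂ = solve-∀
  e₃ : ∀ z y x → 2 * ((z + y) * x) ≡ (2 * z + 2 * y) * x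
  e₃ = solve-∀
  e₄ : ∀ z → 2 * (1 * z) ≡ 2 * z
  e₄ = solve-∀
  Z = 2 * z
  Y = 2 * y
  -- Bernoulli's inequality in the doubled form 1 + y/z ≤ (1 + 1/(2z))^(2y): the larger denominator
  -- brings (1 + 1/(2z))^z down to at most 2.
  base : (z + y) * Z ^ Y ≤ z * (Z + 1) ^ Y
  base = *-cancelˡ-≤ 2 (begin
    2 * ((z + y) * Z ^ Y)  ≡⟨ e₃ z y (Z ^ Y) ⟩
    (Z + Y) * Z ^ Y        ≤⟨ bernoulli Z Y ⟩
    Z * (Z + 1) ^ Y        ≡⟨ *-assoc 2 z _ ⟩
    2 * (z * (Z + 1) ^ Y)  ∎)
  exp-bound : (z + y) ^ z ≤ 2 ^ (2 * y) * z ^ z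
  exp-bound = *-cancelʳ-≤ _ _ (Z ^ (z * Y)) {{m^n≢0 Z (z * Y)}} (begin
    (z + y) ^ z * Z ^ (z * Y)             ≡⟨ cong (λ t → (z + y) ^ z * Z ^ t) (*-comm z Y) ⟩
    (z + y) ^ z * Z ^ (Y * z)             ≡⟨ cong ((z + y) ^ z *_) (sym (^-*-assoc Z Y z)) ⟩
    (z + y) ^ z * (Z ^ Y) ^ z             ≡⟨ sym (^-distribʳ-* (z + y) (Z ^ Y) z) ⟩
    ((z + y) * Z ^ Y) ^ z                 ≤⟨ ^-monoˡ-≤ z base ⟩
    (z * (Z + 1) ^ Y) ^ z                 ≡⟨ ^-distribʳ-* z ((Z + 1) ^ Y) z ⟩
    z ^ z * ((Z + 1) ^ Y) ^ z             ≡⟨ cong (z ^ z *_) (^-*-assoc (Z + 1) Y z) ⟩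
    z ^ z * (Z + 1) ^ (Y * z)             ≡⟨ cong (λ t → z ^ z * (Z + 1) ^ t) (*-comm Y z) ⟩
    z ^ z * (Z + 1) ^ (z * Y)             ≡⟨ cong (z ^ z *_) (sym (^-*-assoc (Z + 1) z Y)) ⟩
    z ^ z * ((Z + 1) ^ z) ^ Y             ≤⟨ *-monoʳ-≤ (z ^ z) (^-monoˡ-≤ Y
                                               (^-ratio-≤2 1 z Z (≤-reflexive (e₄ z)))) ⟩
    z ^ z * (2 * Z ^ z) ^ Y               ≡⟨ cong (z ^ z *_) (^-distribʳ-* 2 (Z ^ z) Y) ⟩
    z ^ z * (2 ^ Y * (Z ^ z) ^ Y)         ≡⟨ cong (λ t → z ^ z * (2 ^ Y * t)) (^-*-assoc Z z Y) ⟩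
    z ^ z * (2 ^ Y * Z ^ (z * Y))         ≡⟨ e₅ (z ^ z) (2 ^ Y) (Z ^ (z * Y)) ⟩
    2 ^ Y * z ^ z * Z ^ (z * Y)           ∎)
    where
    e₅ : ∀ a b c → a * (b * c) ≡ b * a * c
    e₅ = solve-∀

-- Finite sums, products and counts

∑ ∏ : ∀ {n} → (Fin n → ℕ) → ℕ
∑ {zero}  f = 0
∑ {suc n} f = f zero + ∑ (f ∘ suc)
∏ {zero}  f = 1
∏ {suc n} f = f zero * ∏ (f ∘ suc)

∑-cong : ∀ {n} {f g : Fin n → ℕ} → f ≗ g → ∑ f ≡ ∑ g
∑-cong {zero}  e = refl
∑-cong {suc n} e = cong₂ _+_ (e zero) (∑-cong (e ∘ suc))

∏-cong : ∀ {n} {f g : Fin n → ℕ} → f ≗ g → ∏ f ≡ ∏ g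
∏-cong {zero}  e = refl
∏-cong {suc n} e = cong₂ _*_ (e zero) (∏-cong (e ∘ suc))

∑-mono : ∀ {n} {f g : Fin n → ℕ} → (∀ i → f i ≤ g i) → ∑ f ≤ ∑ g
∑-mono {zero}  h = z≤n
∑-mono {suc n} h = +-mono-≤ (h zero) (∑-mono (h ∘ suc))

∏-mono : ∀ {n} {f g : Fin n → ℕ} → (∀ i → f i ≤ g i) → ∏ f ≤ ∏ g
∏-mono {zero}  h = ≤-refl
∏-mono {suc n} h = *-mono-≤ (h zero) (∏-mono (h ∘ suc))

∑-+ : ∀ {n} (f g : Fin n → ℕ) → ∑ (λ i → f i + g i) ≡ ∑ f + ∑ g
∑-+ {zero}  f g = refl
∑-+ {suc n} f g rewrite ∑-+ (f ∘ suc) (g ∘ suc) = e (f zero) (g zero) _ _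
  where
  e : ∀ a b c d → a + b + (c + d) ≡ a + c + (b + d)
  e = solve-∀

∑-*ˡ : ∀ {n} c (f : Fin n → ℕ) → ∑ (λ i → c * f i) ≡ c * ∑ f
∑-*ˡ {zero}  c f = sym (*-zeroʳ c)
∑-*ˡ {suc n} c f rewrite ∑-*ˡ c (f ∘ suc) = sym (*-distribˡ-+ c (f zero) _)

∑-0 : ∀ {n} → ∑ {n} (λ _ → 0) ≡ 0
∑-0 {zero}  = refl
∑-0 {suc n} = ∑-0 {n}

term≤∑ : ∀ {n} (f : Fin n → ℕ) i → f i ≤ ∑ f
term≤∑ f zero    = m≤m+n _ _
term≤∑ f (suc i) = ≤-trans (term≤∑ (f ∘ suc) i) (m≤n+m _ _)

∑-swap : ∀ {n k} (f : Fin n → Fin k → ℕ) → ∑ (λ i → ∑ (f i)) ≡ ∑ (λ j → ∑ (λ i → f i j))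
∑-swap {zero}  {k} f = sym (∑-0 {k})
∑-swap {suc n} {k} f rewrite ∑-swap (f ∘ suc) = sym (∑-+ (f zero) (λ j → ∑ (λ i → f (suc i) j)))

∏-* : ∀ {n} (f g : Fin n → ℕ) → ∏ (λ i → f i * g i) ≡ ∏ f * ∏ g
∏-* {zero}  f g = refl
∏-* {suc n} f g rewrite ∏-* (f ∘ suc) (g ∘ suc) = e (f zero) (g zero) _ _
  where
  e : ∀ a b c d → a * b * (c * d) ≡ a * c * (b * d)
  e = solve-∀

∏-const : ∀ {n} c → ∏ {n} (λ _ → c) ≡ c ^ n
∏-const {zero}  c = refl
∏-const {suc n} c = cong (c *_) (∏-const {n} c)

∏-^ : ∀ {n} c (f : Fin n → ℕ) → ∏ (λ i → c ^ f i) ≡ c ^ ∑ f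
∏-^ {zero}  c f = refl
∏-^ {suc n} c f rewrite ∏-^ c (f ∘ suc) = sym (^-distribˡ-+-* c (f zero) _)

𝟙 : Bool → ℕ
𝟙 b = if b then 1 else 0

countFin≡∑ : ∀ {n} (f : Fin n → Bool) → countFin f ≡ ∑ (𝟙 ∘ f)
countFin≡∑ {zero}  f = refl
countFin≡∑ {suc n} f = cong (𝟙 (f zero) +_) (countFin≡∑ (f ∘ suc))

countFin-mono : ∀ {n} {f g : Fin n → Bool} → (∀ i → f i ≡ true → g i ≡ true) → countFin f ≤ countFin g
countFin-mono {zero} h = z≤n
countFin-mono {suc n} {f} {g} h = +-mono-≤ (head (f zero) (g zero) (h zero)) (countFin-mono (h ∘ suc))
  where
  head : ∀ b c → (b ≡ true → c ≡ true) → 𝟙 b ≤ 𝟙 c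
  head false _ _ = z≤n
  head true  c h rewrite h refl = ≤-refl

≟-suc : ∀ {n} (i j : Fin n) → ⌊ suc i ≟ suc j ⌋ ≡ ⌊ i ≟ j ⌋
≟-suc i j with i ≟ j
... | yes _ = refl
... | no  _ = refl

≟-refl : ∀ {n} (i : Fin n) → ⌊ i ≟ i ⌋ ≡ true
≟-refl i with i ≟ i
... | yes _  = refl
... | no i≢i = contradiction refl i≢i

-- This turns an exponential of a cardinality, (a/b)^|S|, into a product with one factor per item,
-- whose expectation over a random subset factors.
∏-tilt : ∀ {n} a b (S : Fin n → Bool) → ∏ (λ i → if S i then a else b) * b ^ countFin S ≡ a ^ countFin S * b ^ n
∏-tilt {zero} a b S = refl
∏-tilt {suc n} a b S with S zero
... | true  = trans (e₁ a b _ _) (trans (cong (a * b *_) (∏-tilt a b (S ∘ suc))) (e₂ a b (a ^ countFin (S ∘ suc)) (b ^ n)))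
  where
  e₁ : ∀ a b x y → a * x * (b * y) ≡ a * b * (x * y)
  e₁ = solve-∀
  e₂ : ∀ a b x y → a * b * (x * y) ≡ a * x * (b * y)
  e₂ = solve-∀
... | false = trans (*-assoc b _ _) (trans (cong (b *_) (∏-tilt a b (S ∘ suc))) (e₃ b (a ^ countFin (S ∘ suc)) (b ^ n)))
  where
  e₃ : ∀ b x y → b * (x * y) ≡ x * (b * y)
  e₃ = solve-∀

∏-tilt-≤ : ∀ {U} a b n (S : Fin U → Bool) .{{_ : NonZero b}} → b ≤ a → countFin S ≤ n →
  ∏ (λ i → if S i then a else b) * b ^ n ≤ a ^ n * b ^ U
∏-tilt-≤ {U} a b n S b≤a S≤n = begin
  Π * b ^ n                ≡⟨ cong (λ t → Π * b ^ t) (sym split) ⟩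
  Π * b ^ (c + d)          ≡⟨ cong (Π *_) (^-distribˡ-+-* b c d) ⟩
  Π * (b ^ c * b ^ d)      ≡⟨ *-assoc Π _ _ ⟨
  Π * b ^ c * b ^ d        ≡⟨ cong (_* b ^ d) (∏-tilt a b S) ⟩
  a ^ c * b ^ U * b ^ d    ≤⟨ *-monoʳ-≤ (a ^ c * b ^ U) (^-monoˡ-≤ d b≤a) ⟩
  a ^ c * b ^ U * a ^ d    ≡⟨ e (a ^ c) (b ^ U) (a ^ d) ⟩
  a ^ c * a ^ d * b ^ U    ≡⟨ cong (_* b ^ U) (sym (^-distribˡ-+-* a c d)) ⟩
  a ^ (c + d) * b ^ U      ≡⟨ cong (λ t → a ^ t * b ^ U) split ⟩
  a ^ n * b ^ U            ∎
  where
  open ≤-Reasoning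
  Π = ∏ (λ i → if S i then a else b)
  c = countFin S
  d = n ∸ c
  split : c + d ≡ n
  split = m+[n∸m]≡n S≤n
  e : ∀ x y z → x * y * z ≡ x * z * y
  e = solve-∀

∏-tilt-≥ : ∀ {U} a b n (S : Fin U → Bool) .{{_ : NonZero b}} → b ≤ a → n ≤ countFin S →
  a ^ n * b ^ U ≤ ∏ (λ i → if S i then a else b) * b ^ n
∏-tilt-≥ {U} a b n S b≤a n≤S = *-cancelʳ-≤ _ _ (b ^ d) {{m^n≢0 b d}} (begin
  a ^ n * b ^ U * b ^ d    ≤⟨ *-monoʳ-≤ (a ^ n * b ^ U) (^-monoˡ-≤ d b≤a) ⟩
  a ^ n * b ^ U * a ^ d    ≡⟨ e (a ^ n) (b ^ U) (a ^ d) ⟩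
  a ^ n * a ^ d * b ^ U    ≡⟨ cong (_* b ^ U) (sym (^-distribˡ-+-* a n d)) ⟩
  a ^ (n + d) * b ^ U      ≡⟨ cong (λ t → a ^ t * b ^ U) split ⟩
  a ^ c * b ^ U            ≡⟨ sym (∏-tilt a b S) ⟩
  Π * b ^ c                ≡⟨ cong (λ t → Π * b ^ t) (sym split) ⟩
  Π * b ^ (n + d)          ≡⟨ cong (Π *_) (^-distribˡ-+-* b n d) ⟩
  Π * (b ^ n * b ^ d)      ≡⟨ *-assoc Π _ _ ⟨
  Π * b ^ n * b ^ d        ∎)
  where
  open ≤-Reasoning
  Π = ∏ (λ i → if S i then a else b)
  c = countFin S
  d = c ∸ n
  split : n + d ≡ c
  split = m+[n∸m]≡n n≤S
  e : ∀ x y z → x * y * z ≡ x * z * y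
  e = solve-∀

-- Sums over hash functions and negative association of the bins

sumL : ∀ {A : Set} → (A → ℕ) → List A → ℕ
sumL f []       = 0
sumL f (x ∷ xs) = f x + sumL f xs

sumL-++ : ∀ {A : Set} (f : A → ℕ) xs ys → sumL f (xs ++ ys) ≡ sumL f xs + sumL f ys
sumL-++ f []       ys = refl
sumL-++ f (x ∷ xs) ys rewrite sumL-++ f xs ys = sym (+-assoc (f x) _ _)

sumL-map : ∀ {A B : Set} (f : B → ℕ) (g : A → B) xs → sumL f (map g xs) ≡ sumL (f ∘ g) xs
sumL-map f g []       = refl
sumL-map f g (x ∷ xs) = cong (f (g x) +_) (sumL-map f g xs)

sumL-cong : ∀ {A : Set} {f g : A → ℕ} → f ≗ g → ∀ xs → sumL f xs ≡ sumL g xs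
sumL-cong e []       = refl
sumL-cong e (x ∷ xs) = cong₂ _+_ (e x) (sumL-cong e xs)

sumL-concatMap-tabulate : ∀ {A B : Set} {n} (f : B → ℕ) (g : A → List B) (h : Fin n → A) →
  sumL f (concatMap g (tabulate h)) ≡ ∑ (λ i → sumL f (g (h i)))
sumL-concatMap-tabulate {n = zero}  f g h = refl
sumL-concatMap-tabulate {n = suc n} f g h =
  trans (sumL-++ f (g (h zero)) _) (cong (sumL f (g (h zero)) +_) (sumL-concatMap-tabulate f g (h ∘ suc)))

sumL-allVecs : ∀ m U (f : Vec (Fin m) (suc U) → ℕ) →
  sumL f (allVecs m (suc U)) ≡ ∑ (λ b → sumL (f ∘ (b ∷_)) (allVecs m U))
sumL-allVecs m U f = trans (sumL-concatMap-tabulate f (λ b → map (b ∷_) (allVecs m U)) (λ b → b))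
  (∑-cong (λ b → sumL-map f (b ∷_) (allVecs m U)))

countL*≤sumL : ∀ {A : Set} (f : A → Bool) (g : A → ℕ) K → (∀ x → f x ≡ true → K ≤ g x) →
  ∀ xs → countL f xs * K ≤ sumL g xs
countL*≤sumL f g K h []       = z≤n
countL*≤sumL f g K h (x ∷ xs) = begin
  (𝟙 (f x) + countL f xs) * K      ≡⟨ *-distribʳ-+ K (𝟙 (f x)) _ ⟩
  𝟙 (f x) * K + countL f xs * K    ≤⟨ +-mono-≤ (head (f x) (h x)) (countL*≤sumL f g K h xs) ⟩
  g x + sumL g xs                  ∎
  where
  open ≤-Reasoning
  head : ∀ b → (b ≡ true → K ≤ g x) → 𝟙 b * K ≤ g x
  head false _ = z≤n
  head true  h = subst (_≤ g x) (sym (+-identityʳ K)) (h refl)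

bucket : ∀ {m U} → Vec (Fin m) U → Fin m → Vec Bool U
bucket H b = Vec.map (λ c → ⌊ c ≟ b ⌋) H

-- The expectation of g over a random subset containing each item with probability 1/(m′+1), times (m′+1)^U.
W : ∀ m′ U → (Vec Bool U → ℕ) → ℕ
W m′ zero    g = g []
W m′ (suc U) g = m′ * W m′ U (g ∘ (false ∷_)) + W m′ U (g ∘ (true ∷_))

W-cong : ∀ m′ U {f g : Vec Bool U → ℕ} → f ≗ g → W m′ U f ≡ W m′ U g
W-cong m′ zero    e = e []
W-cong m′ (suc U) e = cong₂ (λ x y → m′ * x + y) (W-cong m′ U (e ∘ (false ∷_))) (W-cong m′ U (e ∘ (true ∷_)))

W-mono : ∀ m′ U {f g : Vec Bool U → ℕ} → (∀ R → f R ≤ g R) → W m′ U f ≤ W m′ U g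
W-mono m′ zero    h = h []
W-mono m′ (suc U) h = +-mono-≤ (*-monoʳ-≤ m′ (W-mono m′ U (h ∘ (false ∷_)))) (W-mono m′ U (h ∘ (true ∷_)))

W-+ : ∀ m′ U (f g : Vec Bool U → ℕ) → W m′ U (λ R → f R + g R) ≡ W m′ U f + W m′ U g
W-+ m′ zero    f g = refl
W-+ m′ (suc U) f g
  rewrite W-+ m′ U (f ∘ (false ∷_)) (g ∘ (false ∷_)) | W-+ m′ U (f ∘ (true ∷_)) (g ∘ (true ∷_)) = e m′ _ _ _ _
  where
  e : ∀ k a b c d → k * (a + b) + (c + d) ≡ k * a + c + (k * b + d)
  e = solve-∀

W-*ˡ : ∀ m′ U c (f : Vec Bool U → ℕ) → W m′ U (λ R → c * f R) ≡ c * W m′ U f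
W-*ˡ m′ zero    c f = refl
W-*ˡ m′ (suc U) c f
  rewrite W-*ˡ m′ U c (f ∘ (false ∷_)) | W-*ˡ m′ U c (f ∘ (true ∷_)) = e m′ c _ _
  where
  e : ∀ k c a b → k * (c * a) + c * b ≡ c * (k * a + b)
  e = solve-∀

W-const : ∀ m′ U c → W m′ U (λ _ → c) ≡ suc m′ ^ U * c
W-const m′ zero    c = sym (+-identityʳ c)
W-const m′ (suc U) c rewrite W-const m′ U c = e m′ (suc m′ ^ U) c
  where
  e : ∀ k x c → k * (x * c) + x * c ≡ suc k * x * c
  e = solve-∀

W-∑ : ∀ m′ U {n} (f : Fin n → Vec Bool U → ℕ) → W m′ U (λ R → ∑ (λ i → f i R)) ≡ ∑ (λ i → W m′ U (f i))
W-∑ m′ U {zero}  f = trans (W-const m′ U 0) (*-zeroʳ (suc m′ ^ U))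
W-∑ m′ U {suc n} f = trans (W-+ m′ U (f zero) _) (cong (W m′ U (f zero) +_) (W-∑ m′ U (f ∘ suc)))

W-∏ : ∀ m′ U (φ : Fin U → Bool → ℕ) →
  W m′ U (λ R → ∏ (λ i → φ i (lookup R i))) ≡ ∏ (λ i → m′ * φ i false + φ i true)
W-∏ m′ zero    φ = refl
W-∏ m′ (suc U) φ
  rewrite W-*ˡ m′ U (φ zero false) (λ R → ∏ (λ i → φ (suc i) (lookup R i)))
        | W-*ˡ m′ U (φ zero true)  (λ R → ∏ (λ i → φ (suc i) (lookup R i)))
        | W-∏ m′ U (φ ∘ suc) = e m′ (φ zero false) (φ zero true) _
  where
  e : ∀ k a b x → k * (a * x) + b * x ≡ (k * a + b) * x
  e = solve-∀

Monotone : ∀ {U} → (Vec Bool U → ℕ) → Set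
Monotone {U} g = ∀ R R′ → (∀ i → lookup R i ≡ true → lookup R′ i ≡ true) → g R ≤ g R′

∷-mono : ∀ {U} b (R R′ : Vec Bool U) → (∀ i → lookup R i ≡ true → lookup R′ i ≡ true) →
  ∀ i → lookup (b ∷ R) i ≡ true → lookup (b ∷ R′) i ≡ true
∷-mono b R R′ h zero    e = e
∷-mono b R R′ h (suc i) e = h i e

false∷≤true∷ : ∀ {U} (R : Vec Bool U) i → lookup (false ∷ R) i ≡ true → lookup (true ∷ R) i ≡ true
false∷≤true∷ R zero    ()
false∷≤true∷ R (suc i) e = e

-- With y = x + D, the product ∏ (M x + D), M = m′ + 1, dominates the constant and first-order terms
-- of its expansion in D; the right summand compensates for k ≠ M.
∏-first-order : ∀ {k} m′ (x y : Fin k → ℕ) → (∀ b → x b ≤ y b) → let M = suc m′ in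
  M ^ k * ∑ (λ b₀ → ∏ (λ b → if ⌊ b₀ ≟ b ⌋ then y b else x b)) + M ^ k * (M * ∏ x)
  ≤ M * ∏ (λ b → m′ * x b + y b) + k * (M ^ k * ∏ x)
∏-first-order {zero}  m′ x y x≤y = ≤-reflexive (e m′)
  where
  e : ∀ k → 1 * 0 + 1 * (suc k * 1) ≡ suc k * 1 + 0
  e = solve-∀
∏-first-order {suc k} m′ x y x≤y = begin
  M * M ^ k * F + M * M ^ k * (M * (x zero * p))
    ≡⟨ cong (λ t → M * M ^ k * t + M * M ^ k * (M * (x zero * p))) F≡ ⟩
  M * M ^ k * (y zero * p + x zero * F′) + M * M ^ k * (M * (x zero * p))
    ≡⟨ cong (λ t → M * M ^ k * (t * p + x zero * F′) + M * M ^ k * (M * (x zero * p))) (sym y≡) ⟩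
  M * M ^ k * ((x zero + D) * p + x zero * F′) + M * M ^ k * (M * (x zero * p))
    ≡⟨ e₁ M (M ^ k) (x zero) D p F′ ⟩
  M * (D * (M ^ k * p)) + M * M ^ k * (x zero * p) + M * x zero * (M ^ k * F′ + M ^ k * (M * p))
    -- The increment `D` of the first bin is charged to the constant term of the remaining product;
    -- the other increments are handled by the induction hypothesis.
    ≤⟨ +-mono-≤ (+-monoˡ-≤ _ (*-monoʳ-≤ M (*-monoʳ-≤ D constant-term)))
                (*-monoʳ-≤ (M * x zero) (∏-first-order m′ (x ∘ suc) (y ∘ suc) (x≤y ∘ suc))) ⟩
  M * (D * P) + M * M ^ k * (x zero * p) + M * x zero * (M * P + k * (M ^ k * p))
    ≡⟨ e₂ m′ k (M ^ k) (x zero) D p P ⟩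
  M * ((m′ * x zero + (x zero + D)) * P) + suc k * (M * M ^ k * (x zero * p))
    ≡⟨ cong (λ t → M * ((m′ * x zero + t) * P) + suc k * (M * M ^ k * (x zero * p))) y≡ ⟩
  M * ((m′ * x zero + y zero) * P) + suc k * (M * M ^ k * (x zero * p)) ∎
  where
  open ≤-Reasoning
  M = suc m′
  D = y zero ∸ x zero
  y≡ : x zero + D ≡ y zero
  y≡ = m+[n∸m]≡n (x≤y zero)
  p = ∏ (x ∘ suc)
  P = ∏ (λ b → m′ * x (suc b) + y (suc b))
  F = ∑ (λ b₀ → ∏ (λ b → if ⌊ b₀ ≟ b ⌋ then y b else x b))
  F′ = ∑ (λ b₀ → ∏ (λ b → if ⌊ b₀ ≟ b ⌋ then y (suc b) else x (suc b)))
  F≡ : F ≡ y zero * p + x zero * F′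
  F≡ = cong (y zero * p +_) (trans
    (∑-cong (λ b₀ → cong (x zero *_) (∏-cong (λ b →
      cong (λ t → if t then y (suc b) else x (suc b)) (≟-suc b₀ b)))))
    (∑-*ˡ (x zero) (λ b₀ → ∏ (λ b → if ⌊ b₀ ≟ b ⌋ then y (suc b) else x (suc b)))))
  constant-term : M ^ k * p ≤ P
  constant-term = begin
    M ^ k * p                      ≡⟨ cong (_* p) (sym (∏-const {k} M)) ⟩
    ∏ {k} (λ _ → M) * p            ≡⟨ sym (∏-* (λ _ → M) (x ∘ suc)) ⟩
    ∏ (λ b → M * x (suc b))        ≤⟨ ∏-mono (λ b → ≤-trans (≤-reflexive (+-comm (x (suc b)) _))
                                        (+-monoʳ-≤ (m′ * x (suc b)) (x≤y (suc b)))) ⟩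
    P                              ∎
  e₁ : ∀ M Mk x D p F → M * Mk * ((x + D) * p + x * F) + M * Mk * (M * (x * p))
     ≡ M * (D * (Mk * p)) + M * Mk * (x * p) + M * x * (Mk * F + Mk * (M * p))
  e₁ = solve-∀
  e₂ : ∀ m′ k Mk x D p P →
    suc m′ * (D * P) + suc m′ * Mk * (x * p) + suc m′ * x * (suc m′ * P + k * (Mk * p))
    ≡ suc m′ * ((m′ * x + (x + D)) * P) + suc k * (suc m′ * Mk * (x * p))
  e₂ = solve-∀

-- With as many factors as bins, the two compensating terms of `∏-first-order` coincide and cancel.
-- Divided by M^(M+1), this is negative association for a single item: the mean over its bin `b₀` of
-- the product is at most the product of the means.
∑-∏-select : ∀ m′ (x y : Fin (suc m′) → ℕ) → (∀ b → x b ≤ y b) → let M = suc m′ in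
  M ^ M * ∑ (λ b₀ → ∏ (λ b → if ⌊ b₀ ≟ b ⌋ then y b else x b)) ≤ M * ∏ (λ b → m′ * x b + y b)
∑-∏-select m′ x y x≤y = +-cancelʳ-≤ (suc m′ * (suc m′ ^ suc m′ * ∏ x)) _ _
  (≤-trans
  (≤-reflexive (cong (M ^ M * F +_) (e M (M ^ M) (∏ x)))) (∏-first-order m′ x y x≤y))
  where
  M = suc m′
  F = ∑ (λ b₀ → ∏ (λ b → if ⌊ b₀ ≟ b ⌋ then y b else x b))
  e : ∀ a b c → a * (b * c) ≡ b * (a * c)
  e = solve-∀

-- Negative association of the bins: conditioning on one item at a time, at most one of the monotone
-- factors is raised, which is what ∑-∏-select bounds.
negative-association : ∀ m′ U (g : Fin (suc m′) → Vec Bool U → ℕ) → (∀ b → Monotone (g b)) → let m = suc m′ in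
  sumL (λ H → ∏ (λ b → g b (bucket H b))) (allVecs m U) * (m ^ U) ^ m ≤ m ^ U * ∏ (λ b → W m′ U (g b))
negative-association m′ zero g mono = ≤-reflexive
  (trans (cong₂ _*_ (+-identityʳ G) (^-zeroˡ (suc m′))) (*-comm G 1))
  where G = ∏ (λ b → g b [])
negative-association m′ (suc U) g mono = begin
  sumL (λ H → ∏ (λ b → g b (bucket H b))) (allVecs m (suc U)) * (m * mU) ^ m
    ≡⟨ cong₂ _*_ (sumL-allVecs m U _) (^-distribʳ-* m mU m) ⟩
  ∑ S * (m ^ m * mU ^ m)
    ≡⟨ e₁ (∑ S) (m ^ m) (mU ^ m) ⟩
  m ^ m * (mU ^ m * ∑ S)
    ≡⟨ cong (m ^ m *_) (sym (∑-*ˡ (mU ^ m) S)) ⟩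
  m ^ m * ∑ (λ b₀ → mU ^ m * S b₀)
    ≤⟨ *-monoʳ-≤ (m ^ m) (∑-mono conditional) ⟩
  m ^ m * ∑ (λ b₀ → mU * S′ b₀)
    ≡⟨ cong (m ^ m *_) (∑-*ˡ mU S′) ⟩
  m ^ m * (mU * ∑ S′)
    ≡⟨ e₂ (m ^ m) mU (∑ S′) ⟩
  mU * (m ^ m * ∑ S′)
    ≤⟨ *-monoʳ-≤ mU (∑-∏-select m′ G₀ G₁ G₀≤G₁) ⟩
  mU * (m * ∏ (λ b → W m′ (suc U) (g b)))
    ≡⟨ e₃ mU m _ ⟩
  m * mU * ∏ (λ b → W m′ (suc U) (g b)) ∎
  where
  open ≤-Reasoning
  m = suc m′
  mU = m ^ U
  G₀ G₁ : Fin m → ℕ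
  G₀ b = W m′ U (g b ∘ (false ∷_))
  G₁ b = W m′ U (g b ∘ (true ∷_))
  G₀≤G₁ : ∀ b → G₀ b ≤ G₁ b
  G₀≤G₁ b = W-mono m′ U (λ R → mono b _ _ (false∷≤true∷ R))
  S S′ : Fin m → ℕ
  S b₀ = sumL (λ H → ∏ (λ b → g b (⌊ b₀ ≟ b ⌋ ∷ bucket H b))) (allVecs m U)
  S′ b₀ = ∏ (λ b → if ⌊ b₀ ≟ b ⌋ then G₁ b else G₀ b)
  select : ∀ b c → W m′ U (g b ∘ (c ∷_)) ≡ (if c then G₁ b else G₀ b)
  select b false = refl
  select b true  = refl
  conditional : ∀ b₀ → mU ^ m * S b₀ ≤ mU * S′ b₀
  conditional b₀ = begin
    mU ^ m * S b₀   ≡⟨ *-comm (mU ^ m) _ ⟩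
    S b₀ * mU ^ m   ≤⟨ negative-association m′ U (λ b → g b ∘ (⌊ b₀ ≟ b ⌋ ∷_))
                         (λ b R R′ h → mono b _ _ (∷-mono ⌊ b₀ ≟ b ⌋ R R′ h)) ⟩
    mU * ∏ (λ b → W m′ U (g b ∘ (⌊ b₀ ≟ b ⌋ ∷_)))
                    ≡⟨ cong (mU *_) (∏-cong (λ b → select b ⌊ b₀ ≟ b ⌋)) ⟩
    mU * S′ b₀       ∎
  e₁ : ∀ a b c → a * (b * c) ≡ b * (c * a)
  e₁ = solve-∀
  e₂ : ∀ a b c → a * (b * c) ≡ b * (a * c)
  e₂ = solve-∀
  e₃ : ∀ a b c → a * (b * c) ≡ b * a * c
  e₃ = solve-∀

-- The overflow of a fixed family of snapshots

sumL-*ʳ : ∀ {A : Set} (f : A → ℕ) c xs → sumL (λ x → f x * c) xs ≡ sumL f xs * c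
sumL-*ʳ f c []       = refl
sumL-*ʳ f c (x ∷ xs) = trans (cong (f x * c +_) (sumL-*ʳ f c xs)) (sym (*-distribʳ-+ c (f x) (sumL f xs)))

∏-select : ∀ {n} c (x : Fin n) → ∏ (λ i → if ⌊ i ≟ x ⌋ then c else 1) ≡ c
∏-select {suc n} c zero = trans (cong (c *_) (trans (∏-const {n} 1) (^-zeroˡ n))) (*-identityʳ c)
∏-select {suc n} c (suc x) = trans (+-identityʳ _)
  (trans (∏-cong (λ i → cong (λ t → if t then c else 1) (≟-suc i x))) (∏-select c x))

m+1≢0 : ∀ m → NonZero (m + 1)
m+1≢0 zero    = _
m+1≢0 (suc m) = _

-- (1 + 1/k)^X ≤ 1 + (X/k) (1 + 1/k)^X.
^-linearise : ∀ k X → k * (k + 1) ^ X ≤ k * k ^ X + X * (k + 1) ^ X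
^-linearise k zero    = m≤m+n (k * 1) 0
^-linearise k (suc X) = begin
  k * ((k + 1) * a)                   ≡⟨ e₁ k a ⟩
  k * (k * a) + k * a                 ≤⟨ +-monoˡ-≤ (k * a) (*-monoʳ-≤ k (^-linearise k X)) ⟩
  k * (k * b + X * a) + k * a         ≤⟨ m≤m+n _ (suc X * a) ⟩
  k * (k * b + X * a) + k * a + suc X * a ≡⟨ e₂ k X a b ⟩
  k * (k * b) + suc X * ((k + 1) * a) ∎
  where
  open ≤-Reasoning
  a = (k + 1) ^ X
  b = k ^ X
  e₁ : ∀ k a → k * ((k + 1) * a) ≡ k * (k * a) + k * a
  e₁ = solve-∀
  e₂ : ∀ k X a b → k * (k * b + X * a) + k * a + suc X * a ≡ k * (k * b) + suc X * ((k + 1) * a)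
  e₂ = solve-∀

∧-trueˡ : ∀ {a b} → a ∧ b ≡ true → a ≡ true
∧-trueˡ {true} _ = refl

∧-trueʳ : ∀ {a b} → a ∧ b ≡ true → b ≡ true
∧-trueʳ {true} e = e

≡true⇒T : ∀ {b} → b ≡ true → T b
≡true⇒T refl = tt

module _ {U : ℕ} (cap : ℕ) (P : Fin U → Bool) (Q : Fin U → Fin U → Bool) where

  -- Whether x, lying in a bin with item set R, must have overflowed when it was last inserted;
  -- Q x is the set of items present at that moment.
  overflows : Vec Bool U → Fin U → Bool
  overflows R x = lookup R x ∧ (P x ∧ (cap ≤ᵇ countFin (λ y → Q x y ∧ lookup R y)))

  overflow : Vec Bool U → ℕ
  overflow R = countFin (overflows R)

  module Potential (k r : ℕ) .{{_ : NonZero k}} .{{_ : NonZero r}} where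

    -- Common denominator: `k ^ U` and `r ^ U` serve the two tilts, one factor per item, and
    -- `(r + 1) ^ cap` serves (1 + 1/r)^(-cap).
    κ : ℕ
    κ = k ^ U * r ^ U * (r + 1) ^ cap

    -- Contribution of item `i` to the summand of `x`. The first factor spreads the indicator of x ∈
    -- R over the items, so that it too becomes part of the product.
    φ : Fin U → Fin U → Bool → ℕ
    φ x i b = (if ⌊ i ≟ x ⌋ then 𝟙 b else 1)
            * ((if P i ∧ b then k + 1 else k) * (if Q x i ∧ b then r + 1 else r))

    -- κ k (1 + (1/k) Σ_{x ∈ P ∩ R} (1 + 1/k)^|P ∩ R| (1 + 1/r)^(|Q x ∩ R| − cap)), an upper bound
    -- for κ k (1 + 1/k)^overflow whose expectation factors over the items.
    potential : Vec Bool U → ℕ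
    potential R = κ * k + r ^ cap * ∑ (λ x → 𝟙 (P x) * ∏ (λ i → φ x i (lookup R i)))

    φ-mono : ∀ x i b b′ → (b ≡ true → b′ ≡ true) → φ x i b ≤ φ x i b′
    φ-mono x i true  b′ h rewrite h refl = ≤-refl
    φ-mono x i false true  h = *-mono-≤ (sel ⌊ i ≟ x ⌋) (*-mono-≤ (tilt k (P i)) (tilt r (Q x i)))
      where
      sel : ∀ c → (if c then 0 else 1) ≤ (if c then 1 else 1)
      sel false = ≤-refl
      sel true  = z≤n
      tilt : ∀ a c → (if c ∧ false then a + 1 else a) ≤ (if c ∧ true then a + 1 else a)
      tilt a false = ≤-refl
      tilt a true  = m≤m+n a 1
    φ-mono x i false false h = ≤-refl

    potential-mono : Monotone potential
    potential-mono R R′ h = +-monoʳ-≤ (κ * k) (*-monoʳ-≤ (r ^ cap) (∑-mono (λ x → *-monoʳ-≤ (𝟙 (P x))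
      (∏-mono (λ i → φ-mono x i (lookup R i) (lookup R′ i) (h i))))))

    -- If `x` overflows, all overflowing items lie in P ∩ R, so the first tilt is at least (1 +
    -- 1/k)^overflow; and at least `cap` items of `Q x` lie in R, so the second tilt outweighs (1 +
    -- 1/r)^(-cap).
    overflow-term : ∀ R x → 𝟙 (overflows R x) * (κ * (k + 1) ^ overflow R)
      ≤ r ^ cap * (𝟙 (P x) * ∏ (λ i → φ x i (lookup R i))) * k ^ overflow R
    overflow-term R x with overflows R x in eq
    ... | false = z≤n
    ... | true  = begin
      κ * (k + 1) ^ X + 0                       ≡⟨ e₁ (k ^ U) (r ^ U) ((r + 1) ^ cap) ((k + 1) ^ X) ⟩
      (k + 1) ^ X * k ^ U * ((r + 1) ^ cap * r ^ U)
        ≤⟨ *-mono-≤ (∏-tilt-≥ (k + 1) k X PR (m≤m+n k 1) X≤PR)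
                    (∏-tilt-≥ (r + 1) r cap QR (m≤m+n r 1) cap≤QR) ⟩
      α * k ^ X * (β * r ^ cap)                 ≡⟨ e₂ α (k ^ X) β (r ^ cap) ⟩
      r ^ cap * (α * β) * k ^ X                 ≤⟨ *-monoˡ-≤ (k ^ X) (*-monoʳ-≤ (r ^ cap) αβ≤) ⟩
      r ^ cap * (1 * Φ) * k ^ X                 ≡⟨ cong (λ t → r ^ cap * (𝟙 t * Φ) * k ^ X) (sym Px) ⟩
      r ^ cap * (𝟙 (P x) * Φ) * k ^ X           ∎
      where
      open ≤-Reasoning
      X = overflow R
      PR QR : Fin U → Bool
      PR i = P i ∧ lookup R i
      QR i = Q x i ∧ lookup R i
      α = ∏ (λ i → if PR i then k + 1 else k)
      β = ∏ (λ i → if QR i then r + 1 else r)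
      Φ = ∏ (λ i → φ x i (lookup R i))
      Rx : lookup R x ≡ true
      Rx = ∧-trueˡ eq
      Px : P x ≡ true
      Px = ∧-trueˡ (∧-trueʳ {lookup R x} eq)
      cap≤QR : cap ≤ countFin QR
      cap≤QR = ≤ᵇ⇒≤ cap _ (≡true⇒T (∧-trueʳ {P x} (∧-trueʳ {lookup R x} eq)))
      X≤PR : X ≤ countFin PR
      X≤PR = countFin-mono (λ i h → cong₂ _∧_ (∧-trueˡ {P i} (∧-trueʳ {lookup R i} h)) (∧-trueˡ {lookup R i} h))
      sel : ∀ i → 1 ≤ (if ⌊ i ≟ x ⌋ then 𝟙 (lookup R i) else 1)
      sel i with i ≟ x
      ... | yes refl rewrite Rx = ≤-refl
      ... | no  _    = ≤-refl
      αβ≤ : α * β ≤ 1 * Φ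
      αβ≤ = begin
        α * β          ≡⟨ sym (∏-* (λ i → if PR i then k + 1 else k) _) ⟩
        ∏ (λ i → (if PR i then k + 1 else k) * (if QR i then r + 1 else r))
                       ≤⟨ ∏-mono (λ i → ≤-trans (≤-reflexive (sym (*-identityˡ _))) (*-monoˡ-≤ _ (sel i))) ⟩
        Φ              ≡⟨ sym (*-identityˡ Φ) ⟩
        1 * Φ          ∎
      e₁ : ∀ a b c d → a * b * c * d + 0 ≡ d * a * (c * b)
      e₁ = solve-∀
      e₂ : ∀ a b c d → a * b * (c * d) ≡ d * (a * c) * b
      e₂ = solve-∀

    potential-≥ : ∀ R → κ * k * (k + 1) ^ overflow R ≤ potential R * k ^ overflow R
    potential-≥ R = begin
      κ * k * a                               ≡⟨ *-assoc κ k a ⟩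
      κ * (k * a)                             ≤⟨ *-monoʳ-≤ κ (^-linearise k X) ⟩
      κ * (k * b + X * a)                     ≡⟨ e₁ κ k b X a ⟩
      κ * k * b + κ * a * X                   ≡⟨ cong (λ t → κ * k * b + κ * a * t) (countFin≡∑ (overflows R)) ⟩
      κ * k * b + κ * a * ∑ (𝟙 ∘ overflows R) ≡⟨ cong (κ * k * b +_) (sym (∑-*ˡ (κ * a) (𝟙 ∘ overflows R))) ⟩
      κ * k * b + ∑ (λ x → κ * a * 𝟙 (overflows R x))
        ≤⟨ +-monoʳ-≤ (κ * k * b) (∑-mono (λ x → begin
             κ * a * 𝟙 (overflows R x)        ≡⟨ *-comm (κ * a) _ ⟩
             𝟙 (overflows R x) * (κ * a)      ≤⟨ overflow-term R x ⟩
             r ^ cap * f x * b                ≡⟨ e₂ (r ^ cap) (f x) b ⟩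
             b * r ^ cap * f x                ∎)) ⟩
      κ * k * b + ∑ (λ x → b * r ^ cap * f x) ≡⟨ cong (κ * k * b +_) (∑-*ˡ (b * r ^ cap) f) ⟩
      κ * k * b + b * r ^ cap * ∑ f           ≡⟨ e₃ (κ * k) b (r ^ cap) (∑ f) ⟩
      (κ * k + r ^ cap * ∑ f) * b             ∎
      where
      open ≤-Reasoning
      X = overflow R
      a = (k + 1) ^ X
      b = k ^ X
      f : Fin U → ℕ
      f x = 𝟙 (P x) * ∏ (λ i → φ x i (lookup R i))
      e₁ : ∀ κ k b X a → κ * (k * b + X * a) ≡ κ * k * b + κ * a * X
      e₁ = solve-∀
      e₂ : ∀ u v w → u * v * w ≡ w * u * v
      e₂ = solve-∀
      e₃ : ∀ u b v w → u * b + b * v * w ≡ (u + v * w) * b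
      e₃ = solve-∀

    module _ (m′ n e : ℕ) (P≤n : countFin P ≤ n) (Q≤n : ∀ x → countFin (Q x) ≤ n)
      (4n≤mk : 4 * n ≤ suc m′ * k)
      (tail : (suc m′ * r + 1) ^ n * r ^ cap * 2 ^ e ≤ (suc m′ * r) ^ n * (r + 1) ^ cap) where

      private
        m N₁ N₂ : ℕ
        m = suc m′
        N₁ = m * k
        N₂ = m * r
        instance
          N₁≢0 : NonZero N₁
          N₁≢0 = m*n≢0 m k
          N₂≢0 : NonZero N₂
          N₂≢0 = m*n≢0 m r

        -- Bounds for the expected tilts of one item. An item in both `P` and `Q x` has correlated
        -- tilts; `N₁ + 2` in place of `N₁ + 1` absorbs the correlation because r ≥ 1, and so allows
        -- the two products to be treated separately.
        u : Fin U → ℕ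
        u i = if P i then N₁ + 2 else N₁
        v : Fin U → Fin U → ℕ
        v x i = if Q x i then N₂ + 1 else N₂

      private
        -- At `i = x` the factor for absence vanishes, so only the chance 1/m of presence remains;
        -- this is the extra `m` on the left. There each tilt is at most doubled, which gives the 4.
        factor-≤ : ∀ x i → (m′ * φ x i false + φ x i true) * m * (if ⌊ i ≟ x ⌋ then m else 1)
          ≤ (if ⌊ i ≟ x ⌋ then 4 else 1) * (u i * v x i)
        factor-≤ x i with i ≟ x
        ... | no _ = cases r (P i) (Q x i)
          where
          e₁ : ∀ m′ k r → (m′ * (1 * ((k) * (suc r))) + 1 * ((k + 1) * (suc r + 1))) * suc m′ * 1 + (suc m′ * r + 2)
             ≡ 1 * ((suc m′ * k + 2) * (suc m′ * suc r + 1))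
          e₁ = solve-∀
          e₂ : ∀ m′ k r → (m′ * (1 * (k * r)) + 1 * ((k + 1) * r)) * suc m′ * 1 + suc m′ * r
             ≡ 1 * ((suc m′ * k + 2) * (suc m′ * r))
          e₂ = solve-∀
          e₃ : ∀ m′ k r → (m′ * (1 * (k * r)) + 1 * (k * (r + 1))) * suc m′ * 1
             ≡ 1 * (suc m′ * k * (suc m′ * r + 1))
          e₃ = solve-∀
          e₄ : ∀ m′ k r → (m′ * (1 * (k * r)) + 1 * (k * r)) * suc m′ * 1
             ≡ 1 * (suc m′ * k * (suc m′ * r))
          e₄ = solve-∀
          cases : ∀ r p q .{{_ : NonZero r}} →
            (m′ * (1 * ((if p ∧ false then k + 1 else k) * (if q ∧ false then r + 1 else r)))
              + 1 * ((if p ∧ true then k + 1 else k) * (if q ∧ true then r + 1 else r))) * m * 1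
            ≤ 1 * ((if p then m * k + 2 else m * k) * (if q then m * r + 1 else m * r))
          cases (suc r) true  true  = ≤-trans (m≤m+n _ _) (≤-reflexive (e₁ m′ k r))
          cases r       true  false = ≤-trans (m≤m+n _ _) (≤-reflexive (e₂ m′ k r))
          cases r       false true  = ≤-reflexive (e₃ m′ k r)
          cases r       false false = ≤-reflexive (e₄ m′ k r)
        ... | yes _ = begin
          (m′ * (0 * ((if P i ∧ false then k + 1 else k) * (if Q x i ∧ false then r + 1 else r)))
            + 1 * (a * b)) * m * m                       ≡⟨ e₁ m′ a b ⟩
          m * a * (m * b)                                ≤⟨ *-mono-≤ (*-monoʳ-≤ m (≤2 k (P i))) (*-monoʳ-≤ m (≤2 r (Q x i))) ⟩
          m * (2 * k) * (m * (2 * r))                    ≡⟨ e₂ m k r ⟩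
          4 * (N₁ * N₂)                                  ≤⟨ *-monoʳ-≤ 4 (*-mono-≤ (N≤ N₁ 2 (P i)) (N≤ N₂ 1 (Q x i))) ⟩
          4 * (u i * v x i)                              ∎
          where
          open ≤-Reasoning
          a = if P i ∧ true then k + 1 else k
          b = if Q x i ∧ true then r + 1 else r
          e₁ : ∀ m′ a b → (m′ * 0 + 1 * (a * b)) * suc m′ * suc m′ ≡ suc m′ * a * (suc m′ * b)
          e₁ = solve-∀
          e₂ : ∀ m k r → m * (2 * k) * (m * (2 * r)) ≡ 4 * (m * k * (m * r))
          e₂ = solve-∀
          ≤2 : ∀ a p .{{_ : NonZero a}} → (if p ∧ true then a + 1 else a) ≤ 2 * a
          ≤2 (suc a) true  = +-monoʳ-≤ (suc a) (s≤s z≤n)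
          ≤2 a       false = m≤m+n a _
          N≤ : ∀ N t p → N ≤ (if p then N + t else N)
          N≤ N t true  = m≤m+n N t
          N≤ N t false = ≤-refl

        factors : Fin U → ℕ
        factors x = ∏ (λ i → m′ * φ x i false + φ x i true)

        factors-≤ : ∀ x → factors x * m ^ U * m ≤ 4 * (∏ u * ∏ (v x))
        factors-≤ x = begin
          factors x * m ^ U * m
            ≡⟨ cong₂ (λ s t → factors x * s * t) (sym (∏-const {U} m)) (sym (∏-select m x)) ⟩
          factors x * ∏ {U} (λ _ → m) * ∏ (λ i → if ⌊ i ≟ x ⌋ then m else 1)
            ≡⟨ cong (_* ∏ (λ i → if ⌊ i ≟ x ⌋ then m else 1)) (sym (∏-* (λ i → m′ * φ x i false + φ x i true) (λ _ → m))) ⟩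
          ∏ (λ i → (m′ * φ x i false + φ x i true) * m) * ∏ (λ i → if ⌊ i ≟ x ⌋ then m else 1)
            ≡⟨ sym (∏-* (λ i → (m′ * φ x i false + φ x i true) * m) _) ⟩
          ∏ (λ i → (m′ * φ x i false + φ x i true) * m * (if ⌊ i ≟ x ⌋ then m else 1))
            ≤⟨ ∏-mono (factor-≤ x) ⟩
          ∏ (λ i → (if ⌊ i ≟ x ⌋ then 4 else 1) * (u i * v x i))
            ≡⟨ ∏-* (λ i → if ⌊ i ≟ x ⌋ then 4 else 1) _ ⟩
          ∏ (λ i → if ⌊ i ≟ x ⌋ then 4 else 1) * ∏ (λ i → u i * v x i)
            ≡⟨ cong₂ _*_ (∏-select 4 x) (∏-* u (v x)) ⟩
          4 * (∏ u * ∏ (v x)) ∎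
          where open ≤-Reasoning

        ∏u-≤ : ∏ u ≤ 2 * N₁ ^ U
        ∏u-≤ = *-cancelʳ-≤ _ _ (N₁ ^ n) {{m^n≢0 N₁ n}} (begin
          ∏ u * N₁ ^ n           ≤⟨ ∏-tilt-≤ (N₁ + 2) N₁ n P (m≤m+n N₁ 2) P≤n ⟩
          (N₁ + 2) ^ n * N₁ ^ U  ≤⟨ *-monoˡ-≤ (N₁ ^ U) (^-ratio-≤2 2 n N₁ (subst (_≤ N₁) (e₁ n) 4n≤mk)) ⟩
          2 * N₁ ^ n * N₁ ^ U    ≡⟨ e₂ (N₁ ^ n) (N₁ ^ U) ⟩
          2 * N₁ ^ U * N₁ ^ n    ∎)
          where
          open ≤-Reasoning
          e₁ : ∀ n → 4 * n ≡ 2 * (2 * n)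
          e₁ = solve-∀
          e₂ : ∀ a b → 2 * a * b ≡ 2 * b * a
          e₂ = solve-∀

        ∏v-≤ : ∀ x → ∏ (v x) * (r ^ cap * 2 ^ e) ≤ (r + 1) ^ cap * N₂ ^ U
        ∏v-≤ x = *-cancelʳ-≤ _ _ (N₂ ^ n) {{m^n≢0 N₂ n}} (begin
          ∏ (v x) * (r ^ cap * 2 ^ e) * N₂ ^ n         ≡⟨ e₁ (∏ (v x)) (r ^ cap) (2 ^ e) (N₂ ^ n) ⟩
          ∏ (v x) * N₂ ^ n * (r ^ cap * 2 ^ e)         ≤⟨ *-monoˡ-≤ (r ^ cap * 2 ^ e) (∏-tilt-≤ (N₂ + 1) N₂ n (Q x) (m≤m+n N₂ 1) (Q≤n x)) ⟩
          (N₂ + 1) ^ n * N₂ ^ U * (r ^ cap * 2 ^ e)    ≡⟨ e₂ ((N₂ + 1) ^ n) (N₂ ^ U) (r ^ cap) (2 ^ e) ⟩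
          (N₂ + 1) ^ n * r ^ cap * 2 ^ e * N₂ ^ U      ≤⟨ *-monoˡ-≤ (N₂ ^ U) tail ⟩
          N₂ ^ n * (r + 1) ^ cap * N₂ ^ U              ≡⟨ e₃ (N₂ ^ n) ((r + 1) ^ cap) (N₂ ^ U) ⟩
          (r + 1) ^ cap * N₂ ^ U * N₂ ^ n              ∎)
          where
          open ≤-Reasoning
          e₁ : ∀ a b c d → a * (b * c) * d ≡ a * d * (b * c)
          e₁ = solve-∀
          e₂ : ∀ a b c d → a * b * (c * d) ≡ a * c * d * b
          e₂ = solve-∀
          e₃ : ∀ a b c → a * b * c ≡ b * c * a
          e₃ = solve-∀

        weighted-factors-≤ : ∀ x → factors x * (m * (r ^ cap * 2 ^ e)) ≤ 8 * (m ^ U * κ)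
        weighted-factors-≤ x = *-cancelʳ-≤ _ _ (m ^ U) {{m^n≢0 m U}} (begin
          factors x * (m * (r ^ cap * 2 ^ e)) * m ^ U
            ≡⟨ e₁ (factors x) m (r ^ cap * 2 ^ e) (m ^ U) ⟩
          factors x * m ^ U * m * (r ^ cap * 2 ^ e)
            ≤⟨ *-monoˡ-≤ (r ^ cap * 2 ^ e) (factors-≤ x) ⟩
          4 * (∏ u * ∏ (v x)) * (r ^ cap * 2 ^ e)
            ≡⟨ e₂ (∏ u) (∏ (v x)) (r ^ cap * 2 ^ e) ⟩
          4 * (∏ u * (∏ (v x) * (r ^ cap * 2 ^ e)))
            ≤⟨ *-monoʳ-≤ 4 (*-mono-≤ ∏u-≤ (∏v-≤ x)) ⟩
          4 * (2 * N₁ ^ U * ((r + 1) ^ cap * N₂ ^ U))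
            ≡⟨ cong₂ (λ s t → 4 * (2 * s * ((r + 1) ^ cap * t))) (^-distribʳ-* m k U) (^-distribʳ-* m r U) ⟩
          4 * (2 * (m ^ U * k ^ U) * ((r + 1) ^ cap * (m ^ U * r ^ U)))
            ≡⟨ e₃ (m ^ U) (k ^ U) ((r + 1) ^ cap) (r ^ U) ⟩
          8 * (m ^ U * κ) * m ^ U ∎)
          where
          open ≤-Reasoning
          e₁ : ∀ a b c d → a * (b * c) * d ≡ a * d * b * c
          e₁ = solve-∀
          e₂ : ∀ a b c → 4 * (a * b) * c ≡ 4 * (a * (b * c))
          e₂ = solve-∀
          e₃ : ∀ a b c d → 4 * (2 * (a * b) * (c * (a * d))) ≡ 8 * (a * (b * d * c)) * a
          e₃ = solve-∀

        W-potential : W m′ U potential ≡ m ^ U * (κ * k) + r ^ cap * ∑ (λ x → 𝟙 (P x) * factors x)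
        W-potential = trans (W-+ m′ U (λ _ → κ * k) _) (cong₂ _+_ (W-const m′ U (κ * k))
          (trans (W-*ˡ m′ U (r ^ cap) _) (cong (r ^ cap *_)
            (trans (W-∑ m′ U (λ x R → 𝟙 (P x) * ∏ (λ i → φ x i (lookup R i))))
                   (∑-cong (λ x → trans (W-*ˡ m′ U (𝟙 (P x)) _) (cong (𝟙 (P x) *_) (W-∏ m′ U (φ x)))))))))

      -- Divided by the normalisation, the expected potential is at most 1 + 8n/(mk 2^e): each of at
      -- most `n` items of `P` lies in the bin with probability 1/m, and its tilts cost 8/2^e, where
      -- 8 is the 4 of `factors-≤` times the 2 of `∏u-≤`.
      W-potential-≤ : W m′ U potential * (suc m′ * (k * 2 ^ e))
        ≤ suc m′ ^ U * (κ * k) * (suc m′ * (k * 2 ^ e) + 8 * n)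
      W-potential-≤ = begin
        W m′ U potential * z
          ≡⟨ cong (_* z) W-potential ⟩
        (A + r ^ cap * ∑ f) * z
          ≡⟨ e₁ A (r ^ cap) (∑ f) m k (2 ^ e) ⟩
        A * z + k * (m * (r ^ cap * 2 ^ e) * ∑ f)
          ≡⟨ cong (λ t → A * z + k * t) (sym (∑-*ˡ (m * (r ^ cap * 2 ^ e)) f)) ⟩
        A * z + k * ∑ (λ x → m * (r ^ cap * 2 ^ e) * f x)
          ≤⟨ +-monoʳ-≤ (A * z) (*-monoʳ-≤ k (∑-mono (λ x → begin
               m * (r ^ cap * 2 ^ e) * (𝟙 (P x) * factors x)  ≡⟨ e₂ (m * (r ^ cap * 2 ^ e)) (𝟙 (P x)) (factors x) ⟩
               factors x * (m * (r ^ cap * 2 ^ e)) * 𝟙 (P x)  ≤⟨ *-monoˡ-≤ (𝟙 (P x)) (weighted-factors-≤ x) ⟩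
               8 * (m ^ U * κ) * 𝟙 (P x)                      ∎))) ⟩
        A * z + k * ∑ (λ x → 8 * (m ^ U * κ) * 𝟙 (P x))
          ≡⟨ cong (λ t → A * z + k * t) (∑-*ˡ (8 * (m ^ U * κ)) (𝟙 ∘ P)) ⟩
        A * z + k * (8 * (m ^ U * κ) * ∑ (𝟙 ∘ P))
          ≡⟨ cong (λ t → A * z + k * (8 * (m ^ U * κ) * t)) (sym (countFin≡∑ P)) ⟩
        A * z + k * (8 * (m ^ U * κ) * countFin P)
          ≤⟨ +-monoʳ-≤ (A * z) (*-monoʳ-≤ k (*-monoʳ-≤ (8 * (m ^ U * κ)) P≤n)) ⟩
        A * z + k * (8 * (m ^ U * κ) * n)
          ≡⟨ e₃ (m ^ U) κ k z n ⟩
        A * (z + 8 * n) ∎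
        where
        open ≤-Reasoning
        z = m * (k * 2 ^ e)
        A = m ^ U * (κ * k)
        f : Fin U → ℕ
        f x = 𝟙 (P x) * factors x
        e₁ : ∀ A c s m k E → (A + c * s) * (m * (k * E)) ≡ A * (m * (k * E)) + k * (m * (c * E) * s)
        e₁ = solve-∀
        e₂ : ∀ a b c → a * (b * c) ≡ c * a * b
        e₂ = solve-∀
        e₃ : ∀ a κ k z n → a * (κ * k) * z + k * (8 * (a * κ) * n) ≡ a * (κ * k) * (z + 8 * n)
        e₃ = solve-∀

      private
        D : ℕ
        D = κ * k

        D≢0 : NonZero D
        D≢0 = m*n≢0 κ k {{m*n≢0 (k ^ U * r ^ U) ((r + 1) ^ cap)
          {{m*n≢0 (k ^ U) (r ^ U) {{m^n≢0 k U}} {{m^n≢0 r U}}}} {{m^n≢0 (r + 1) cap {{m+1≢0 r}}}}}}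

        product-≥ : ∀ (H : Vec (Fin m) U) t → t ≤ ∑ (λ b → overflow (bucket H b)) →
          D ^ m * (k + 1) ^ t ≤ ∏ (λ b → potential (bucket H b)) * k ^ t
        product-≥ H t t≤X = begin
          D ^ m * (k + 1) ^ t  ≡⟨ *-comm (D ^ m) _ ⟩
          (k + 1) ^ t * D ^ m  ≤⟨ shorten k (k + 1) t X (D ^ m) Π (m≤m+n k 1) t≤X full ⟩
          k ^ t * Π            ≡⟨ *-comm (k ^ t) Π ⟩
          Π * k ^ t            ∎
          where
          open ≤-Reasoning
          x : Fin m → ℕ
          x b = overflow (bucket H b)
          X = ∑ x
          Π = ∏ (λ b → potential (bucket H b))
          full : (k + 1) ^ X * D ^ m ≤ k ^ X * Π
          full = begin
            (k + 1) ^ X * D ^ m                      ≡⟨ cong₂ _*_ (sym (∏-^ (k + 1) x)) (sym (∏-const {m} D)) ⟩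
            ∏ (λ b → (k + 1) ^ x b) * ∏ {m} (λ _ → D) ≡⟨ *-comm (∏ (λ b → (k + 1) ^ x b)) _ ⟩
            ∏ {m} (λ _ → D) * ∏ (λ b → (k + 1) ^ x b) ≡⟨ sym (∏-* (λ _ → D) (λ b → (k + 1) ^ x b)) ⟩
            ∏ (λ b → D * (k + 1) ^ x b)              ≤⟨ ∏-mono (λ b → potential-≥ (bucket H b)) ⟩
            ∏ (λ b → potential (bucket H b) * k ^ x b) ≡⟨ ∏-* (λ b → potential (bucket H b)) (λ b → k ^ x b) ⟩
            Π * ∏ (λ b → k ^ x b)                    ≡⟨ cong (Π *_) (∏-^ k x) ⟩
            Π * k ^ X                                ≡⟨ *-comm Π _ ⟩
            k ^ X * Π                                ∎

      -- As a probability, the event `V` has measure at most (1 + 1/k)^(-t) (1 + 8n/(mk 2^e))^m: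
      -- Markov's inequality for the product of the potentials over all bins.
      markov : ∀ (V : Vec (Fin (suc m′)) U → Bool) t →
        (∀ H → V H ≡ true → t ≤ ∑ (λ b → overflow (bucket H b))) →
        countL V (allVecs (suc m′) U) * (k + 1) ^ t * (suc m′ * (k * 2 ^ e)) ^ suc m′
        ≤ k ^ t * suc m′ ^ U * (suc m′ * (k * 2 ^ e) + 8 * n) ^ suc m′
      markov V t h = *-cancelʳ-≤ _ _ (D ^ m * (m ^ U) ^ m) {{K≢0}} (begin
        c * (k + 1) ^ t * z ^ m * (D ^ m * (m ^ U) ^ m)
          ≡⟨ e₁ c ((k + 1) ^ t) (z ^ m) (D ^ m) ((m ^ U) ^ m) ⟩
        c * (D ^ m * (k + 1) ^ t) * ((m ^ U) ^ m * z ^ m)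
          ≤⟨ *-monoˡ-≤ ((m ^ U) ^ m * z ^ m) (countL*≤sumL V _ (D ^ m * (k + 1) ^ t)
               (λ H VH → product-≥ H t (h H VH)) (allVecs m U)) ⟩
        sumL (λ H → Π H * k ^ t) (allVecs m U) * ((m ^ U) ^ m * z ^ m)
          ≡⟨ cong (_* ((m ^ U) ^ m * z ^ m)) (sumL-*ʳ Π (k ^ t) (allVecs m U)) ⟩
        sumL Π (allVecs m U) * k ^ t * ((m ^ U) ^ m * z ^ m)
          ≡⟨ e₂ (sumL Π (allVecs m U)) (k ^ t) ((m ^ U) ^ m) (z ^ m) ⟩
        sumL Π (allVecs m U) * (m ^ U) ^ m * (k ^ t * z ^ m)
          ≤⟨ *-monoˡ-≤ (k ^ t * z ^ m) (negative-association m′ U (λ _ → potential) (λ _ → potential-mono)) ⟩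
        m ^ U * ∏ {m} (λ _ → w) * (k ^ t * z ^ m)
          ≡⟨ cong (λ s → m ^ U * s * (k ^ t * z ^ m)) (∏-const {m} w) ⟩
        m ^ U * w ^ m * (k ^ t * z ^ m)
          ≡⟨ e₃ (m ^ U) (w ^ m) (k ^ t) (z ^ m) ⟩
        k ^ t * m ^ U * (w ^ m * z ^ m)
          ≡⟨ cong (k ^ t * m ^ U *_) (sym (^-distribʳ-* w z m)) ⟩
        k ^ t * m ^ U * (w * z) ^ m
          ≤⟨ *-monoʳ-≤ (k ^ t * m ^ U) (^-monoˡ-≤ m W-potential-≤) ⟩
        k ^ t * m ^ U * (m ^ U * D * (z + 8 * n)) ^ m
          ≡⟨ cong (k ^ t * m ^ U *_) (trans (^-distribʳ-* (m ^ U * D) (z + 8 * n) m)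
               (cong (_* (z + 8 * n) ^ m) (^-distribʳ-* (m ^ U) D m))) ⟩
        k ^ t * m ^ U * ((m ^ U) ^ m * D ^ m * (z + 8 * n) ^ m)
          ≡⟨ e₄ (k ^ t * m ^ U) ((m ^ U) ^ m) (D ^ m) ((z + 8 * n) ^ m) ⟩
        k ^ t * m ^ U * (z + 8 * n) ^ m * (D ^ m * (m ^ U) ^ m) ∎)
        where
        open ≤-Reasoning
        c = countL V (allVecs m U)
        z = m * (k * 2 ^ e)
        w = W m′ U potential
        Π : Vec (Fin m) U → ℕ
        Π H = ∏ (λ b → potential (bucket H b))
        K≢0 : NonZero (D ^ m * (m ^ U) ^ m)
        K≢0 = m*n≢0 (D ^ m) ((m ^ U) ^ m) {{m^n≢0 D m {{D≢0}}}} {{m^n≢0 (m ^ U) m {{m^n≢0 m U}}}}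
        e₁ : ∀ a b c d f → a * b * c * (d * f) ≡ a * (d * b) * (f * c)
        e₁ = solve-∀
        e₂ : ∀ a b c d → a * b * (c * d) ≡ a * c * (b * d)
        e₂ = solve-∀
        e₃ : ∀ a b c d → a * b * (c * d) ≡ c * a * (b * d)
        e₃ = solve-∀
        e₄ : ∀ a b c d → a * (b * c * d) ≡ a * d * (c * b)
        e₄ = solve-∀

      -- The threshold is split by purpose: `t₁` cancels the moment generating function by `budget`,
      -- and `t₂` alone yields the failure probability 1/N.
      overflow-count : ∀ (V : Vec (Fin (suc m′)) U → Bool) t₁ t₂ N →
        (∀ H → V H ≡ true → t₁ + t₂ ≤ ∑ (λ b → overflow (bucket H b))) →
        2 * (8 * n) ≤ t₁ * 2 ^ e → N * k ^ t₂ ≤ (k + 1) ^ t₂ →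
        countL V (allVecs (suc m′) U) * N ≤ suc m′ ^ U
      overflow-count V t₁ t₂ N h h₁ h₂ = *-cancelʳ-≤ _ _ K {{K≢0}} (begin
        c * N * K
          ≡⟨ e₁ c N ((k + 1) ^ t₁) (z ^ m) (k ^ t₂) ⟩
        c * ((k + 1) ^ t₁ * (N * k ^ t₂)) * z ^ m
          ≤⟨ *-monoˡ-≤ (z ^ m) (*-monoʳ-≤ c (*-monoʳ-≤ ((k + 1) ^ t₁) h₂)) ⟩
        c * ((k + 1) ^ t₁ * (k + 1) ^ t₂) * z ^ m
          ≡⟨ cong (λ s → c * s * z ^ m) (sym (^-distribˡ-+-* (k + 1) t₁ t₂)) ⟩
        c * (k + 1) ^ (t₁ + t₂) * z ^ m
          ≤⟨ markov V (t₁ + t₂) h ⟩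
        k ^ (t₁ + t₂) * m ^ U * (z + 8 * n) ^ m
          ≡⟨ cong (λ s → s * m ^ U * (z + 8 * n) ^ m) (^-distribˡ-+-* k t₁ t₂) ⟩
        k ^ t₁ * k ^ t₂ * m ^ U * (z + 8 * n) ^ m
          ≡⟨ e₂ (k ^ t₁) (k ^ t₂) (m ^ U) ((z + 8 * n) ^ m) ⟩
        m ^ U * k ^ t₂ * ((z + 8 * n) ^ m * k ^ t₁)
          ≤⟨ *-monoʳ-≤ (m ^ U * k ^ t₂) (budget m k (2 ^ e) (8 * n) t₁ {{it}} {{it}} {{m^n≢0 2 e}} h₁) ⟩
        m ^ U * k ^ t₂ * ((k + 1) ^ t₁ * z ^ m)
          ≡⟨ e₃ (m ^ U) (k ^ t₂) ((k + 1) ^ t₁) (z ^ m) ⟩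
        m ^ U * K ∎)
        where
        open ≤-Reasoning
        c = countL V (allVecs m U)
        z = m * (k * 2 ^ e)
        K = (k + 1) ^ t₁ * (z ^ m * k ^ t₂)
        K≢0 : NonZero K
        w≢0 : NonZero (k * 2 ^ e)
        w≢0 = m*n≢0 k (2 ^ e) {{it}} {{m^n≢0 2 e}}
        z≢0 : NonZero z
        z≢0 = m*n≢0 m (k * 2 ^ e) {{it}} {{w≢0}}
        K≢0 = m*n≢0 ((k + 1) ^ t₁) (z ^ m * k ^ t₂) {{m^n≢0 (k + 1) t₁ {{m+1≢0 k}}}}
          {{m*n≢0 (z ^ m) (k ^ t₂) {{m^n≢0 z m {{z≢0}}}} {{m^n≢0 k t₂}}}}
        e₁ : ∀ a b c d f → a * b * (c * (d * f)) ≡ a * (c * (b * f)) * d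
        e₁ = solve-∀
        e₂ : ∀ a b c d → a * b * c * d ≡ c * b * (d * a)
        e₂ = solve-∀
        e₃ : ∀ a b c d → a * b * (c * d) ≡ a * (c * (d * b))
        e₃ = solve-∀

-- Back yard dynamics

T⇒≡true : ∀ {b} → T b → b ≡ true
T⇒≡true {true} _ = refl

<ᵇ-false⇒≥ : ∀ a b → (a <ᵇ b) ≡ false → b ≤ a
<ᵇ-false⇒≥ a b eq with b ≤? a
... | yes b≤a = b≤a
... | no  b≰a = contradiction (trans (sym (T⇒≡true (<⇒<ᵇ (≰⇒> b≰a)))) eq) λ ()

countFin-setB-true : ∀ {U} (P : Fin U → Bool) x → countFin (setB P x true) ≤ suc (countFin P)
countFin-setB-true {U} P x = begin
  countFin (setB P x true)                ≡⟨ countFin≡∑ (setB P x true) ⟩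
  ∑ (𝟙 ∘ setB P x true)                   ≤⟨ ∑-mono term ⟩
  ∑ (λ i → 𝟙 ⌊ i ≟ x ⌋ + 𝟙 (P i))         ≡⟨ ∑-+ (λ i → 𝟙 ⌊ i ≟ x ⌋) (𝟙 ∘ P) ⟩
  ∑ (λ i → 𝟙 ⌊ i ≟ x ⌋) + ∑ (𝟙 ∘ P)       ≡⟨ cong₂ _+_ (single x) (sym (countFin≡∑ P)) ⟩
  suc (countFin P)                        ∎
  where
  open ≤-Reasoning
  term : ∀ i → 𝟙 (setB P x true i) ≤ 𝟙 ⌊ i ≟ x ⌋ + 𝟙 (P i)
  term i with i ≟ x
  ... | yes _ = s≤s z≤n
  ... | no  _ = ≤-refl
  single : ∀ {U} (x : Fin U) → ∑ (λ i → 𝟙 ⌊ i ≟ x ⌋) ≡ 1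
  single {suc U} zero    = cong suc (∑-0 {U})
  single {suc U} (suc x) = trans (∑-cong (λ i → cong 𝟙 (≟-suc i x))) (single x)

countFin-setB-false : ∀ {U} (P : Fin U → Bool) x → countFin (setB P x false) ≤ countFin P
countFin-setB-false P x = countFin-mono h
  where
  h : ∀ i → setB P x false i ≡ true → P i ≡ true
  h i eq with i ≟ x
  ... | no _ = eq

-- Only an insertion rewrites the record of `x`. No hash value enters, so the same family serves all
-- hash functions.
snapshot : ∀ {U} → (Fin U → Fin U → Bool) → Fin U → (Fin U → Bool) → Fin U → Fin U → Bool
snapshot Q x P i = if ⌊ i ≟ x ⌋ then P else Q i

module _ {m U : ℕ} (cap : ℕ) where

  -- Q i is the set of items that were present just before the last insertion of i.
  record Invariant (H : Vec (Fin m) U) (s : State U) (P : Fin U → Bool) (Q : Fin U → Fin U → Bool) : Set where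
    field
      front⇒present : ∀ i → isFront (s i) ≡ true → P i ≡ true
      back⇒present  : ∀ i → isBack (s i) ≡ true → P i ≡ true
      back⇒full     : ∀ i → isBack (s i) ≡ true → cap ≤ countFin (λ y → Q i y ∧ ⌊ lookup H y ≟ lookup H i ⌋)
  open Invariant

  invariant-ins : ∀ {H s P Q} x → Invariant H s P Q →
    Invariant H (step cap H s (ins x)) (setB P x true) (snapshot Q x P)
  invariant-ins {H} {s} {P} {Q} x I = record { front⇒present = f ; back⇒present = b ; back⇒full = o }
    where
    l : Loc
    l = if load H s (lookup H x) <ᵇ cap then front else back
    f : ∀ i → isFront (update s x l i) ≡ true → setB P x true i ≡ true
    f i eq with i ≟ x
    ... | yes _ = refl
    ... | no  _ = front⇒present I i eq
    b : ∀ i → isBack (update s x l i) ≡ true → setB P x true i ≡ true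
    b i eq with i ≟ x
    ... | yes _ = refl
    ... | no  _ = back⇒present I i eq
    -- The load counts only front-yard items, but these are all present; back-yard items of the same
    -- bin can only enlarge the right side. Hence a full bin shows in `P` alone.
    load≤ : load H s (lookup H x) ≤ countFin (λ y → P y ∧ ⌊ lookup H y ≟ lookup H x ⌋)
    load≤ = countFin-mono (λ y eq → cong₂ _∧_ (front⇒present I y (∧-trueˡ {isFront (s y)} eq)) (∧-trueʳ {isFront (s y)} eq))
    o : ∀ i → isBack (update s x l i) ≡ true →
      cap ≤ countFin (λ y → snapshot Q x P i y ∧ ⌊ lookup H y ≟ lookup H i ⌋)
    o i eq with i ≟ x
    ... | no  _ = back⇒full I i eq
    ... | yes refl with load H s (lookup H x) <ᵇ cap in full
    ...   | false = ≤-trans (<ᵇ-false⇒≥ _ cap full) load≤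

  invariant-del : ∀ {H s P Q} x → Invariant H s P Q → Invariant H (step cap H s (del x)) (setB P x false) Q
  invariant-del {H} {s} {P} {Q} x I = record { front⇒present = f ; back⇒present = b ; back⇒full = o }
    where
    f : ∀ i → isFront (update s x absent i) ≡ true → setB P x false i ≡ true
    f i eq with i ≟ x
    ... | no  _ = front⇒present I i eq
    b : ∀ i → isBack (update s x absent i) ≡ true → setB P x false i ≡ true
    b i eq with i ≟ x
    ... | no  _ = back⇒present I i eq
    o : ∀ i → isBack (update s x absent i) ≡ true → cap ≤ countFin (λ y → Q i y ∧ ⌊ lookup H y ≟ lookup H i ⌋)
    o i eq with i ≟ x
    ... | no  _ = back⇒full I i eq

  backyard≤present : ∀ {H s P Q} → Invariant H s P Q → backyard s ≤ countFin P
  backyard≤present I = countFin-mono (back⇒present I)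

  backyard≤overflow : ∀ {H s P Q} → Invariant H s P Q → backyard s ≤ ∑ (λ b → overflow cap P Q (bucket H b))
  backyard≤overflow {H} {s} {P} {Q} I = begin
    backyard s                                            ≡⟨ countFin≡∑ (isBack ∘ s) ⟩
    ∑ (𝟙 ∘ isBack ∘ s)                                    ≤⟨ ∑-mono own-bin ⟩
    ∑ (λ i → ∑ (λ b → 𝟙 (overflows cap P Q (bucket H b) i))) ≡⟨ ∑-swap (λ i b → 𝟙 (overflows cap P Q (bucket H b) i)) ⟩
    ∑ (λ b → ∑ (𝟙 ∘ overflows cap P Q (bucket H b)))      ≡⟨ ∑-cong (λ b → sym (countFin≡∑ (overflows cap P Q (bucket H b)))) ⟩
    ∑ (λ b → overflow cap P Q (bucket H b))               ∎
    where
    open ≤-Reasoning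
    lookup-bucket : ∀ b i → lookup (bucket H b) i ≡ ⌊ lookup H i ≟ b ⌋
    lookup-bucket b i = lookup-map i (λ c → ⌊ c ≟ b ⌋) H
    back⇒overflows : ∀ i → isBack (s i) ≡ true → overflows cap P Q (bucket H (lookup H i)) i ≡ true
    back⇒overflows i eq = cong₂ _∧_ (trans (lookup-bucket _ i) (≟-refl (lookup H i)))
      (cong₂ _∧_ (back⇒present I i eq) (T⇒≡true (≤⇒≤ᵇ (≤-trans (back⇒full I i eq)
        (countFin-mono (λ y h → cong₂ _∧_ (∧-trueˡ {Q i y} h)
          (trans (lookup-bucket _ y) (∧-trueʳ {Q i y} h))))))))
    own-bin : ∀ i → 𝟙 (isBack (s i)) ≤ ∑ (λ b → 𝟙 (overflows cap P Q (bucket H b) i))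
    own-bin i with isBack (s i) in eq
    ... | false = z≤n
    ... | true  = ≤-trans (≤-reflexive (cong 𝟙 (sym (back⇒overflows i eq))))
                    (term≤∑ (λ b → 𝟙 (overflows cap P Q (bucket H b) i)) (lookup H i))

-- Union bound over the moments of time

countL-∨ : ∀ {A : Set} (f g : A → Bool) xs → countL (λ x → f x ∨ g x) xs ≤ countL f xs + countL g xs
countL-∨ f g []       = z≤n
countL-∨ f g (x ∷ xs) = ≤-trans (+-mono-≤ (head (f x) (g x)) (countL-∨ f g xs))
  (≤-reflexive (e (𝟙 (f x)) (𝟙 (g x)) (countL f xs) (countL g xs)))
  where
  head : ∀ a b → 𝟙 (a ∨ b) ≤ 𝟙 a + 𝟙 b
  head true  b = s≤s z≤n
  head false b = ≤-refl
  e : ∀ a b c d → a + b + (c + d) ≡ a + c + (b + d)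
  e = solve-∀

countL-false : ∀ {A : Set} (f : A → Bool) → (∀ x → f x ≡ false) → ∀ xs → countL f xs ≡ 0
countL-false f h []       = refl
countL-false f h (x ∷ xs) rewrite h x = countL-false f h xs

module _ {m U : ℕ} (n cap N : ℕ) (V : ℕ → Bool)
  (snapshot-bound : ∀ (s : Vec (Fin m) U → State U) P Q → countFin P ≤ n → (∀ x → countFin (Q x) ≤ n) →
    (∀ H → Invariant cap H (s H) P Q) → countL (λ H → V (backyard (s H))) (allVecs m U) * N ≤ m ^ U) where

  -- The state varies with the hash function while `P` and `Q` are shared by all; the induction
  -- generalises over all three. A sequence of operations has one more moment than operations, hence
  -- `suc (length ops)`.
  union-bound : ∀ ops (s : Vec (Fin m) U → State U) P Q → countFin P ≤ n → (∀ x → countFin (Q x) ≤ n) →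
    (∀ H → Invariant cap H (s H) P Q) → WellFormed n P ops →
    countL (λ H → anyB (map V (backyardTrace cap H (s H) ops))) (allVecs m U) * N ≤ suc (length ops) * m ^ U
  union-bound [] s P Q P≤n Q≤n I wf = begin
    countL (λ H → V (backyard (s H)) ∨ false) Hs * N   ≤⟨ *-monoˡ-≤ N (countL-∨ (λ H → V (backyard (s H))) (λ _ → false) Hs) ⟩
    (c + countL (λ _ → false) Hs) * N                  ≡⟨ cong (λ t → (c + t) * N) (countL-false (λ _ → false) (λ _ → refl) Hs) ⟩
    (c + 0) * N                                        ≡⟨ cong (_* N) (+-identityʳ c) ⟩
    c * N                                              ≤⟨ snapshot-bound s P Q P≤n Q≤n I ⟩
    m ^ U                                              ≡⟨ sym (+-identityʳ (m ^ U)) ⟩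
    1 * m ^ U                                          ∎
    where
    open ≤-Reasoning
    Hs = allVecs m U
    c = countL (λ H → V (backyard (s H))) Hs
  union-bound (op ∷ ops) s P Q P≤n Q≤n I wf = begin
    countL (λ H → V (backyard (s H)) ∨ rest H) Hs * N      ≤⟨ *-monoˡ-≤ N (countL-∨ (λ H → V (backyard (s H))) rest Hs) ⟩
    (countL (λ H → V (backyard (s H))) Hs + countL rest Hs) * N ≡⟨ *-distribʳ-+ N (countL (λ H → V (backyard (s H))) Hs) (countL rest Hs) ⟩
    countL (λ H → V (backyard (s H))) Hs * N + countL rest Hs * N
      ≤⟨ +-mono-≤ (snapshot-bound s P Q P≤n Q≤n I) (later op wf) ⟩
    m ^ U + suc (length ops) * m ^ U                       ∎
    where
    open ≤-Reasoning
    Hs = allVecs m U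
    rest : Vec (Fin m) U → Bool
    rest H = anyB (map V (backyardTrace cap H (step cap H (s H) op) ops))
    later : ∀ op → WellFormed n P (op ∷ ops) →
      countL (λ H → anyB (map V (backyardTrace cap H (step cap H (s H) op) ops))) Hs * N ≤ suc (length ops) * m ^ U
    later (ins x) (_ , P<n , wf) = union-bound ops _ (setB P x true) (snapshot Q x P)
      (≤-trans (countFin-setB-true P x) P<n) Q′≤n (λ H → invariant-ins cap x (I H)) wf
      where
      Q′≤n : ∀ i → countFin (snapshot Q x P i) ≤ n
      Q′≤n i with i ≟ x
      ... | yes _ = P≤n
      ... | no  _ = Q≤n i
    later (del x) (_ , wf) = union-bound ops _ (setB P x false) Q
      (≤-trans (countFin-setB-false P x) P≤n) Q≤n (λ H → invariant-del cap x (I H)) wf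

-- Choice of the parameters

÷*≤ : ∀ a b → (a ÷ b) * b ≤ a
÷*≤ a zero    = z≤n
÷*≤ a (suc b) = m/n*n≤m a (suc b)

m<n*[1+m/n] : ∀ m n .{{_ : NonZero n}} → m < n * suc (m / n)
m<n*[1+m/n] m n = begin-strict
  m                     ≡⟨ m≡m%n+[m/n]*n m n ⟩
  m % n + m / n * n     <⟨ +-monoˡ-< (m / n * n) (m%n<n m n) ⟩
  suc (m / n) * n       ≡⟨ *-comm (suc (m / n)) n ⟩
  n * suc (m / n)       ∎
  where open ≤-Reasoning

n<2^[1+log₂n] : ∀ n → n < 2 ^ suc ⌊log₂ n ⌋
n<2^[1+log₂n] n with 2 ^ suc ⌊log₂ n ⌋ ≤? n
... | no  2^≰n = ≰⇒> 2^≰n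
... | yes 2^≤n = contradiction
  (subst (_≤ ⌊log₂ n ⌋) (⌊log₂[2^n]⌋≡n (suc ⌊log₂ n ⌋)) (⌊log₂⌋-mono-≤ 2^≤n)) 1+n≰n

square : ∀ x → x ^ 2 ≡ x * x
square x = cong (x *_) (*-identityʳ x)

square-cancel-≤ : ∀ x y → x * x ≤ y * y → x ≤ y
square-cancel-≤ x y h with x ≤? y
... | yes x≤y = x≤y
... | no  x≰y = contradiction h (<⇒≱ (*-mono-< (≰⇒> x≰y) (≰⇒> x≰y)))

module Parameters (n m p q cap e : ℕ) .{{_ : NonZero m}} .{{_ : NonZero q}} .{{_ : NonZero e}}
  (e≤j² : e * (q ^ 2 * 256) ≤ p ^ 2)
  (j²≤h : p ^ 2 * m ≤ q ^ 2 * n)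
  (cap-large : p ^ 2 * m * (n + m) < (cap * m ∸ n) ^ 2 * q ^ 2) where

  open ≤-Reasoning

  -- With r = 2 w ≈ Δ / (2 e), (1 + 1/r)^Δ ≥ 4^e, whereas h ≤ w² e keeps the second-order loss below 2^e.
  h Δ w : ℕ
  h = suc (n / m)
  Δ = cap ∸ h
  w = _/_ Δ (4 * e) {{m*n≢0 4 e}}

  private
    Y : ℕ
    Y = cap * m ∸ n
    instance
      [4*e]≢0 : NonZero (4 * e)
      [4*e]≢0 = m*n≢0 4 e

  n<mh : n < m * h
  n<mh = m<n*[1+m/n] n m

  mh≤n+m : m * h ≤ n + m
  mh≤n+m = begin
    m * suc (n / m)   ≡⟨ *-suc m (n / m) ⟩
    m + m * (n / m)   ≡⟨ cong (m +_) (*-comm m (n / m)) ⟩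
    m + n / m * m     ≤⟨ +-monoʳ-≤ m (m/n*n≤m n m) ⟩
    m + n             ≡⟨ +-comm m n ⟩
    n + m             ∎

  256*em≤n : 256 * e * m ≤ n
  256*em≤n = *-cancelʳ-≤ _ _ (q ^ 2) {{m^n≢0 q 2}} (begin
    256 * e * m * q ^ 2       ≡⟨ e₁ e m (q ^ 2) ⟩
    e * (q ^ 2 * 256) * m     ≤⟨ *-monoˡ-≤ m e≤j² ⟩
    p ^ 2 * m                 ≤⟨ j²≤h ⟩
    q ^ 2 * n                 ≡⟨ *-comm (q ^ 2) n ⟩
    n * q ^ 2                 ∎)
    where
    e₁ : ∀ e m q → 256 * e * m * q ≡ e * (q * 256) * m
    e₁ = solve-∀

  private
    Y-large : 256 * e * (m * (n + m)) < Y * Y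
    Y-large = *-cancelʳ-< (q ^ 2) _ _ (begin-strict
      256 * e * (m * (n + m)) * q ^ 2   ≡⟨ e₁ e m (n + m) (q ^ 2) ⟩
      e * (q ^ 2 * 256) * m * (n + m)   ≤⟨ *-monoˡ-≤ (n + m) (*-monoˡ-≤ m e≤j²) ⟩
      p ^ 2 * m * (n + m)               <⟨ cap-large ⟩
      Y ^ 2 * q ^ 2                     ≡⟨ cong (_* q ^ 2) (square Y) ⟩
      Y * Y * q ^ 2                     ∎)
      where
      e₁ : ∀ e m k q → 256 * e * (m * k) * q ≡ e * (q * 256) * m * k
      e₁ = solve-∀

    -- `Y` is `m` times the excess of the capacity over n/m. Rounding n/m up to `h` takes at most
    -- `m` from it, so at least half of `Y` survives.
    2m≤Y : 2 * m ≤ Y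
    2m≤Y = square-cancel-≤ (2 * m) Y (begin
      2 * m * (2 * m)             ≡⟨ e₁ m ⟩
      4 * (m * m)                 ≤⟨ *-mono-≤ 4≤256*e (*-monoʳ-≤ m (m≤n+m m n)) ⟩
      256 * e * (m * (n + m))     ≤⟨ <⇒≤ Y-large ⟩
      Y * Y                       ∎)
      where
      e₁ : ∀ m → 2 * m * (2 * m) ≡ 4 * (m * m)
      e₁ = solve-∀
      4≤256*e : 4 ≤ 256 * e
      4≤256*e = ≤-trans (m≤m+n 4 252) (m≤m*n 256 e)

    Y≤2Δm : Y ≤ 2 * (Δ * m)
    Y≤2Δm = begin
      Y                        ≡⟨ sym (m∸n+n≡m m≤Y) ⟩
      (Y ∸ m) + m              ≤⟨ +-monoʳ-≤ (Y ∸ m) m≤Y∸m ⟩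
      (Y ∸ m) + (Y ∸ m)        ≡⟨ cong (Y ∸ m +_) (sym (+-identityʳ (Y ∸ m))) ⟩
      2 * (Y ∸ m)              ≡⟨ cong (2 *_) (∸-+-assoc (cap * m) n m) ⟩
      2 * (cap * m ∸ (n + m))  ≤⟨ *-monoʳ-≤ 2 (∸-monoʳ-≤ (cap * m) (subst (_≤ n + m) (*-comm m h) mh≤n+m)) ⟩
      2 * (cap * m ∸ h * m)    ≡⟨ cong (2 *_) (sym (*-distribʳ-∸ m cap h)) ⟩
      2 * (Δ * m)              ∎
      where
      m+m≤Y : m + m ≤ Y
      m+m≤Y = subst (_≤ Y) (cong (m +_) (+-identityʳ m)) 2m≤Y
      m≤Y : m ≤ Y
      m≤Y = ≤-trans (m≤m+n m m) m+m≤Y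
      m≤Y∸m : m ≤ Y ∸ m
      m≤Y∸m = m+n≤o⇒m≤o∸n m m+m≤Y

    256*eh<4ΔΔ : 256 * e * h < 4 * (Δ * Δ)
    256*eh<4ΔΔ = *-cancelʳ-< (m * m) _ _ (begin-strict
      256 * e * h * (m * m)        ≡⟨ e₁ e h m ⟩
      256 * e * (m * (m * h))      ≤⟨ *-monoʳ-≤ (256 * e) (*-monoʳ-≤ m mh≤n+m) ⟩
      256 * e * (m * (n + m))      <⟨ Y-large ⟩
      Y * Y                        ≤⟨ *-mono-≤ Y≤2Δm Y≤2Δm ⟩
      2 * (Δ * m) * (2 * (Δ * m))  ≡⟨ e₂ Δ m ⟩
      4 * (Δ * Δ) * (m * m)        ∎)
      where
      e₁ : ∀ e h m → 256 * e * h * (m * m) ≡ 256 * e * (m * (m * h))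
      e₁ = solve-∀
      e₂ : ∀ Δ m → 2 * (Δ * m) * (2 * (Δ * m)) ≡ 4 * (Δ * Δ) * (m * m)
      e₂ = solve-∀

  cap≡h+Δ : cap ≡ h + Δ
  cap≡h+Δ with h ≤? cap
  ... | yes h≤cap = sym (m+[n∸m]≡n h≤cap)
  ... | no  h≰cap = contradiction
    (subst (λ t → 256 * e * h < 4 * (t * t)) (m≤n⇒m∸n≡0 (<⇒≤ (≰⇒> h≰cap))) 256*eh<4ΔΔ) λ ()

  private
    256*e≤h : 256 * e ≤ h
    256*e≤h = <⇒≤ (*-cancelˡ-< m _ _ (begin-strict
      m * (256 * e)   ≡⟨ *-comm m (256 * e) ⟩
      256 * e * m     ≤⟨ 256*em≤n ⟩
      n               <⟨ n<mh ⟩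
      m * h           ∎))

    -- The assumption j ≤ √h enters through `256*e≤h`: since Δ exceeds 8 √(e h), it is also linear
    -- in `e`, which keeps the quotient `w` positive.
    128*e≤Δ : 128 * e ≤ Δ
    128*e≤Δ = *-cancelˡ-≤ 2 (square-cancel-≤ (2 * (128 * e)) (2 * Δ) (begin
      2 * (128 * e) * (2 * (128 * e))   ≡⟨ e₁ e ⟩
      256 * e * (256 * e)               ≤⟨ *-monoʳ-≤ (256 * e) 256*e≤h ⟩
      256 * e * h                       ≤⟨ <⇒≤ 256*eh<4ΔΔ ⟩
      4 * (Δ * Δ)                       ≡⟨ e₂ Δ ⟩
      2 * Δ * (2 * Δ)                   ∎))
      where
      e₁ : ∀ e → 2 * (128 * e) * (2 * (128 * e)) ≡ 256 * e * (256 * e)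
      e₁ = solve-∀
      e₂ : ∀ Δ → 4 * (Δ * Δ) ≡ 2 * Δ * (2 * Δ)
      e₂ = solve-∀

  1≤w : 1 ≤ w
  1≤w = m≥n⇒m/n>0 (≤-trans (*-monoˡ-≤ e (m≤m+n 4 124)) 128*e≤Δ)

  w*4e≤Δ : 2 * w * (2 * e) ≤ Δ
  w*4e≤Δ = ≤-trans (≤-reflexive (e₁ w e)) (m/n*n≤m Δ (4 * e))
    where
    e₁ : ∀ w e → 2 * w * (2 * e) ≡ w * (4 * e)
    e₁ = solve-∀

  -- Origin of 256 = (2 · 4 · 2)²: a factor 2 for rounding n/m up to `h`, the 4 in
  -- `w = Δ / (4 * e)`, and a factor 2 for rounding `w` down, harmless as w ≥ 1.
  h≤wwe : h ≤ w * w * e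
  h≤wwe = *-cancelˡ-≤ (256 * e) {{m*n≢0 256 e}} (begin
    256 * e * h                             ≤⟨ <⇒≤ 256*eh<4ΔΔ ⟩
    4 * (Δ * Δ)                             ≤⟨ *-monoʳ-≤ 4 (*-mono-≤ Δ≤ Δ≤) ⟩
    4 * (4 * e * (w + w) * (4 * e * (w + w))) ≡⟨ e₁ e w ⟩
    256 * e * (w * w * e)                   ∎)
    where
    Δ≤ : Δ ≤ 4 * e * (w + w)
    Δ≤ = ≤-trans (<⇒≤ (m<n*[1+m/n] Δ (4 * e))) (*-monoʳ-≤ (4 * e) (+-monoˡ-≤ w 1≤w))
    e₁ : ∀ e w → 4 * (4 * e * (w + w) * (4 * e * (w + w))) ≡ 256 * e * (w * w * e)
    e₁ = solve-∀

m≤[1+m/n]*n : ∀ m n .{{_ : NonZero n}} → m ≤ suc (m / n) * n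
m≤[1+m/n]*n m n = ≤-trans (<⇒≤ (m<n*[1+m/n] m n)) (≤-reflexive (*-comm n _))

-- Violations of the bound as thresholds for the back yard

violates⇒< : ∀ C d n p q B → violates C d n p q B ≡ true → let e = (p ^ 2) ÷ (q ^ 2 * d) in
  C ^ 4 * 2 ^ (4 * e) * n ^ 3 * ⌊log₂ n ⌋ ^ 2 < (B * 2 ^ e ∸ C * n) ^ 4
violates⇒< C d n p q B eq = <ᵇ⇒< _ _ (≡true⇒T eq)

-- The hypothesis reads (n/m)^4 L² ≤ n. With h ≤ 2n/m it gives h L ≤ 2 n^(1/4) √L, so the deviation
-- 4h(1 + L)c′ ≤ 8hLc′ is at most 16c′ n^(1/4) √L.
threshold-power : ∀ n m h L c′ → 1 ≤ n → 1 ≤ m → 1 ≤ L → m * h ≤ 2 * n → n ^ 4 * L ^ 2 ≤ n * m ^ 4 →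
  (4 * h * (suc L * c′)) ^ 4 ≤ (16 * suc c′) ^ 4 * n ^ 3 * L ^ 2
threshold-power n@(suc _) m@(suc _) h L c′ _ _ 1≤L mh≤2n hyp = begin
  (4 * h * (suc L * c′)) ^ 4            ≤⟨ ^-monoˡ-≤ 4 (*-monoʳ-≤ (4 * h) (*-monoˡ-≤ c′ (+-monoˡ-≤ L 1≤L))) ⟩
  (4 * h * ((L + L) * c′)) ^ 4          ≡⟨ cong (_^ 4) (e₁ h L c′) ⟩
  (8 * c′ * (h * L)) ^ 4                ≡⟨ ^-distribʳ-* (8 * c′) (h * L) 4 ⟩
  (8 * c′) ^ 4 * (h * L) ^ 4            ≡⟨ cong ((8 * c′) ^ 4 *_) (^-distribʳ-* h L 4) ⟩
  (8 * c′) ^ 4 * (h ^ 4 * L ^ 4)        ≡⟨ cong (λ t → (8 * c′) ^ 4 * (h ^ 4 * t)) (^-distribˡ-+-* L 2 2) ⟩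
  (8 * c′) ^ 4 * (h ^ 4 * (L ^ 2 * L ^ 2)) ≡⟨ cong ((8 * c′) ^ 4 *_) (sym (*-assoc (h ^ 4) (L ^ 2) (L ^ 2))) ⟩
  (8 * c′) ^ 4 * (h ^ 4 * L ^ 2 * L ^ 2) ≤⟨ *-monoʳ-≤ ((8 * c′) ^ 4) (*-monoˡ-≤ (L ^ 2) h⁴L²≤16n) ⟩
  (8 * c′) ^ 4 * (2 ^ 4 * n * L ^ 2)    ≡⟨ e₂ ((8 * c′) ^ 4) (2 ^ 4) n (L ^ 2) ⟩
  (8 * c′) ^ 4 * 2 ^ 4 * n * L ^ 2      ≡⟨ cong (λ t → t * n * L ^ 2) (sym (^-distribʳ-* (8 * c′) 2 4)) ⟩
  -- Here n^(1/4) is weakened to the n^(3/4) of the claim.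
  (8 * c′ * 2) ^ 4 * n * L ^ 2          ≤⟨ *-monoˡ-≤ (L ^ 2) (*-mono-≤ (^-monoˡ-≤ 4 16c′≤) (m≤m*n n (n ^ 2) {{m^n≢0 n 2}})) ⟩
  (16 * suc c′) ^ 4 * n ^ 3 * L ^ 2     ∎
  where
  open ≤-Reasoning
  e₁ : ∀ h L c → 4 * h * ((L + L) * c) ≡ 8 * c * (h * L)
  e₁ = solve-∀
  e₂ : ∀ a b c d → a * (b * c * d) ≡ a * b * c * d
  e₂ = solve-∀
  16c′≤ : 8 * c′ * 2 ≤ 16 * suc c′
  16c′≤ = ≤-trans (≤-reflexive (e₃ c′)) (*-monoʳ-≤ 16 (n≤1+n c′))
    where
    e₃ : ∀ c → 8 * c * 2 ≡ 16 * c
    e₃ = solve-∀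
  h⁴L²≤16n : h ^ 4 * L ^ 2 ≤ 2 ^ 4 * n
  h⁴L²≤16n = *-cancelˡ-≤ (m ^ 4) {{m^n≢0 m 4}} (begin
    m ^ 4 * (h ^ 4 * L ^ 2)     ≡⟨ sym (*-assoc (m ^ 4) (h ^ 4) (L ^ 2)) ⟩
    m ^ 4 * h ^ 4 * L ^ 2       ≡⟨ cong (_* L ^ 2) (sym (^-distribʳ-* m h 4)) ⟩
    (m * h) ^ 4 * L ^ 2         ≤⟨ *-monoˡ-≤ (L ^ 2) (^-monoˡ-≤ 4 mh≤2n) ⟩
    (2 * n) ^ 4 * L ^ 2         ≡⟨ cong (_* L ^ 2) (^-distribʳ-* 2 n 4) ⟩
    2 ^ 4 * n ^ 4 * L ^ 2       ≡⟨ *-assoc (2 ^ 4) (n ^ 4) (L ^ 2) ⟩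
    2 ^ 4 * (n ^ 4 * L ^ 2)     ≤⟨ *-monoʳ-≤ (2 ^ 4) hyp ⟩
    2 ^ 4 * (n * m ^ 4)         ≡⟨ e₄ (2 ^ 4) n (m ^ 4) ⟩
    m ^ 4 * (2 ^ 4 * n)         ∎)
    where
    e₄ : ∀ a b c → a * (b * c) ≡ c * (a * b)
    e₄ = solve-∀

-- By contraposition: a smaller `B` is at most 16n/2^e + t, so the part of B 2^e beyond C n is at
-- most t 2^e. The `suc` lifts the rounded quotient so that its multiple by 2^e reaches 16n, the
-- `t₁` needed in `overflow-count`.
large-violation : ∀ C n e K t B → 16 ≤ C → t ^ 4 ≤ C ^ 4 * n ^ 3 * K →
  C ^ 4 * 2 ^ (4 * e) * n ^ 3 * K < (B * 2 ^ e ∸ C * n) ^ 4 →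
  suc (_/_ (16 * n) (2 ^ e) {{m^n≢0 2 e}}) + t ≤ B
large-violation C n e K t B 16≤C t⁴≤ viol with suc (_/_ (16 * n) (2 ^ e) {{m^n≢0 2 e}}) + t ≤? B
... | yes le = le
... | no  nle = contradiction viol (≤⇒≯ (begin
  (B * E ∸ C * n) ^ 4               ≤⟨ ^-monoˡ-≤ 4 excess ⟩
  (t * E) ^ 4                       ≡⟨ ^-distribʳ-* t E 4 ⟩
  t ^ 4 * E ^ 4                     ≤⟨ *-monoˡ-≤ (E ^ 4) t⁴≤ ⟩
  C ^ 4 * n ^ 3 * K * E ^ 4         ≡⟨ cong (C ^ 4 * n ^ 3 * K *_) (trans (^-*-assoc 2 e 4) (cong (2 ^_) (*-comm e 4))) ⟩
  C ^ 4 * n ^ 3 * K * 2 ^ (4 * e)   ≡⟨ e₁ (C ^ 4) (n ^ 3) K (2 ^ (4 * e)) ⟩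
  C ^ 4 * 2 ^ (4 * e) * n ^ 3 * K   ∎))
  where
  open ≤-Reasoning
  E = 2 ^ e
  instance
    E≢0 : NonZero (2 ^ e)
    E≢0 = m^n≢0 2 e
  e₁ : ∀ a b c d → a * b * c * d ≡ a * d * b * c
  e₁ = solve-∀
  excess : B * E ∸ C * n ≤ t * E
  excess = m≤n+o⇒m∸n≤o (B * E) (C * n) (begin
    B * E                             ≤⟨ *-monoˡ-≤ E (m<1+n⇒m≤n (≰⇒> nle)) ⟩
    (16 * n / E + t) * E              ≡⟨ *-distribʳ-+ E (16 * n / E) t ⟩
    16 * n / E * E + t * E            ≤⟨ +-monoˡ-≤ (t * E) (≤-trans (m/n*n≤m (16 * n) E) (*-monoˡ-≤ n 16≤C)) ⟩
    C * n + t * E                     ∎)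

no-violation : ∀ C n e K B → e ≡ 0 → 1 ≤ C → B ≤ n → ¬ (K < (B * 2 ^ e ∸ C * n) ^ 4)
no-violation C n e K B refl 1≤C B≤n viol = contradiction
  (subst (λ t → K < t ^ 4) (m≤n⇒m∸n≡0 (subst (_≤ C * n) (*-comm 1 B) (*-mono-≤ 1≤C B≤n))) viol) λ ()

-- Bounds at a fixed time and the conclusion

module _ (a c : ℕ) where

  private
    -- In `c′`, the summand `c` is the target exponent and `suc a` pays for the union bound, as 1 +
    -- m^a ≤ 2 n^a ≤ n^(a+1). In `C`, 16 covers 16n/2^e and 16c′ covers the deviation.
    C c′ : ℕ
    c′ = c + suc a
    C  = 16 * suc c′

  -- For small j the exponent is 0 and the claim is only that the back yard holds O(n) items, which
  -- is certain. The case is split off because the choice of `w` divides by `e`.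
  snapshot-bound-zero : ∀ n m p q cap U N → (p ^ 2) ÷ (q ^ 2 * 256) ≡ 0 →
    (s : Vec (Fin m) U → State U) (P : Fin U → Bool) (Q : Fin U → Fin U → Bool) → countFin P ≤ n →
    (∀ H → Invariant cap H (s H) P Q) →
    countL (λ H → violates C 256 n p q (backyard (s H))) (allVecs m U) * N ≤ m ^ U
  snapshot-bound-zero n m p q cap U N e≡0 s P Q P≤n I =
    subst (λ t → t * N ≤ m ^ U) (sym (countL-false _ safe (allVecs m U))) z≤n
    where
    safe : ∀ H → violates C 256 n p q (backyard (s H)) ≡ false
    safe H with violates C 256 n p q (backyard (s H)) in eq
    ... | false = refl
    ... | true  = contradiction (violates⇒< C 256 n p q (backyard (s H)) eq)
      (no-violation C n ((p ^ 2) ÷ (q ^ 2 * 256)) (C ^ 4 * 2 ^ (4 * ((p ^ 2) ÷ (q ^ 2 * 256))) * n ^ 3 * ⌊log₂ n ⌋ ^ 2)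
        (backyard (s H)) e≡0 (s≤s z≤n) (≤-trans (backyard≤present cap (I H)) P≤n))

  module _ (n m′ p q c₀ U : ℕ) .{{_ : NonZero q}}
    .{{_ : NonZero ((p ^ 2) ÷ (q ^ 2 * 256))}}
    (h≤ : n ^ 4 * ⌊log₂ n ⌋ ^ 2 ≤ n * suc m′ ^ 4)
    (j²≤h : p ^ 2 * suc m′ ≤ q ^ 2 * n)
    (cap-large : p ^ 2 * suc m′ * (n + suc m′) < (suc c₀ * suc m′ ∸ n) ^ 2 * q ^ 2) where

    private
      m cap e k r t₂ : ℕ
      m = suc m′
      cap = suc c₀
      e = (p ^ 2) ÷ (q ^ 2 * 256)

    open Parameters n m p q cap e (÷*≤ (p ^ 2) (q ^ 2 * 256)) j²≤h cap-large

    private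
      -- `r` is `2 * w` in successor form, as `chernoff` refers to r - 1. As (1 + 1/k)^k ≥ 2, the
      -- exponent `t₂` yields a factor of at least 2^((1 + ⌊log₂ n⌋) c′) ≥ n^c′.
      k = 4 * h
      r = suc (2 * w ∸ 1)
      t₂ = k * (suc ⌊log₂ n ⌋ * c′)

      instance
        2^e≢0 : NonZero (2 ^ e)
        2^e≢0 = m^n≢0 2 e

      2w≡r : 2 * w ≡ r
      2w≡r = sym (m+[n∸m]≡n (≤-trans 1≤w (m≤m+n w _)))

    -- A nonzero exponent forces j² ≥ 256, and j² is at most n/m. Thus `m ≤ n` and `2 ≤ n` come for
    -- free in this case.
    256*m≤n : 256 * m ≤ n
    256*m≤n = ≤-trans (*-monoˡ-≤ m (m≤m*n 256 e)) 256*em≤n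

    m≤n : m ≤ n
    m≤n = ≤-trans (m≤n*m m 256) 256*m≤n

    2≤n : 2 ≤ n
    2≤n = ≤-trans (≤-trans (m≤m+n 2 254) (m≤m*n 256 m)) 256*m≤n

    private
      tail : (m * r + 1) ^ n * r ^ cap * 2 ^ e ≤ (m * r) ^ n * (r + 1) ^ cap
      tail = subst (λ t → (m * r + 1) ^ n * r ^ t * 2 ^ e ≤ (m * r) ^ n * (r + 1) ^ t) (sym cap≡h+Δ)
        (chernoff m n w (2 * w ∸ 1) e h Δ (s≤s z≤n) 1≤w 2w≡r (<⇒≤ n<mh) h≤wwe
          (subst (λ t → t * (2 * e) ≤ Δ) 2w≡r w*4e≤Δ))

      4n≤mk : 4 * n ≤ m * k
      4n≤mk = ≤-trans (*-monoʳ-≤ 4 (<⇒≤ n<mh)) (≤-reflexive (e₁ m h))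
        where
        e₁ : ∀ m h → 4 * (m * h) ≡ m * (4 * h)
        e₁ = solve-∀

      mh≤2n : m * h ≤ 2 * n
      mh≤2n = ≤-trans mh≤n+m (+-monoʳ-≤ n (≤-trans m≤n (m≤m+n n 0)))

      n^c′*k^t₂≤ : n ^ c′ * k ^ t₂ ≤ (k + 1) ^ t₂
      n^c′*k^t₂≤ = begin
        n ^ c′ * k ^ t₂                          ≤⟨ *-monoˡ-≤ (k ^ t₂) (^-monoˡ-≤ c′ (<⇒≤ (n<2^[1+log₂n] n))) ⟩
        (2 ^ suc ⌊log₂ n ⌋) ^ c′ * k ^ t₂        ≡⟨ cong (_* k ^ t₂) (^-*-assoc 2 (suc ⌊log₂ n ⌋) c′) ⟩
        2 ^ (suc ⌊log₂ n ⌋ * c′) * k ^ t₂        ≡⟨ *-comm (2 ^ (suc ⌊log₂ n ⌋ * c′)) _ ⟩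
        k ^ t₂ * 2 ^ (suc ⌊log₂ n ⌋ * c′)        ≤⟨ doubling k (k + 1) k t₂ (suc ⌊log₂ n ⌋ * c′) (m≤m+n k 1) (2*N^N≤[N+1]^N k) ≤-refl ⟩
        (k + 1) ^ t₂                             ∎
        where open ≤-Reasoning

    snapshot-bound-pos : ∀ N → N ≤ n ^ c′ → (s : Vec (Fin m) U → State U) (P : Fin U → Bool) (Q : Fin U → Fin U → Bool) →
      countFin P ≤ n → (∀ x → countFin (Q x) ≤ n) → (∀ H → Invariant cap H (s H) P Q) →
      countL (λ H → violates C 256 n p q (backyard (s H))) (allVecs m U) * N ≤ m ^ U
    snapshot-bound-pos N N≤ s P Q P≤n Q≤n I =
      Potential.overflow-count cap P Q k r m′ n e P≤n Q≤n 4n≤mk tail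
        (λ H → violates C 256 n p q (backyard (s H))) (suc (16 * n / 2 ^ e)) t₂ N
        (λ H viol → ≤-trans
          (large-violation C n e (⌊log₂ n ⌋ ^ 2) t₂ (backyard (s H)) (m≤m*n 16 (suc c′))
            (threshold-power n m h ⌊log₂ n ⌋ c′ (≤-trans (s≤s z≤n) 2≤n) (s≤s z≤n) (⌊log₂⌋-mono-≤ 2≤n) mh≤2n h≤)
            (violates⇒< C 256 n p q (backyard (s H)) viol))
          (backyard≤overflow cap (I H)))
        (≤-trans (≤-reflexive (sym (*-assoc 2 8 n))) (m≤[1+m/n]*n (16 * n) (2 ^ e)))
        (≤-trans (*-monoˡ-≤ (k ^ t₂) N≤) n^c′*k^t₂≤)

  from-snapshots : ∀ (n m p q cap U : ℕ) (ops : List (Op U)) → WellFormed n (λ _ → false) ops →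
    (∀ (s : Vec (Fin m) U → State U) P Q → countFin P ≤ n → (∀ x → countFin (Q x) ≤ n) →
      (∀ H → Invariant cap H (s H) P Q) →
      countL (λ H → violates C 256 n p q (backyard (s H))) (allVecs m U) * (n ^ c * suc (length ops)) ≤ m ^ U) →
    badCount C 256 n p q cap m U ops * n ^ c ≤ m ^ U
  from-snapshots n m p q cap U ops wf bound = *-cancelʳ-≤ _ _ (suc (length ops)) (begin
    badCount C 256 n p q cap m U ops * n ^ c * suc (length ops)   ≡⟨ *-assoc (badCount C 256 n p q cap m U ops) _ _ ⟩
    badCount C 256 n p q cap m U ops * (n ^ c * suc (length ops))
      ≤⟨ union-bound n cap _ (violates C 256 n p q) bound ops (λ _ → emptyState) (λ _ → false) (λ _ _ → false)
           none (λ _ → none) (λ H → record { front⇒present = λ _ () ; back⇒present = λ _ () ; back⇒full = λ _ () }) wf ⟩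
    suc (length ops) * m ^ U                                      ≡⟨ *-comm (suc (length ops)) _ ⟩
    m ^ U * suc (length ops)                                      ∎)
    where
    open ≤-Reasoning
    none : countFin {U} (λ _ → false) ≤ n
    none = subst (_≤ n) (sym (trans (countFin≡∑ {U} (λ _ → false)) (∑-0 {U}))) z≤n

theorem2p1 : ∀ (a c : ℕ) → ∃[ C ] ∃[ d ] (1 ≤ d × (∀ (n m p q cap U : ℕ) (ops : List (Op U)) →
    1 ≤ n → 1 ≤ m → 1 ≤ q →
    n ^ 4 * ⌊log₂ n ⌋ ^ 2 ≤ n * m ^ 4 →
    p ^ 2 * m ≤ q ^ 2 * n →
    IsCapacity n m p q cap →
    length ops ≤ m ^ a →
    WellFormed n (λ _ → false) ops →
    badCount C d n p q cap m U ops * n ^ c ≤ m ^ U))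
theorem2p1 a c = 16 * suc (c + suc a) , 256 , s≤s z≤n , bound
  where
  open ≤-Reasoning
  bound : ∀ (n m p q cap U : ℕ) (ops : List (Op U)) → 1 ≤ n → 1 ≤ m → 1 ≤ q →
    n ^ 4 * ⌊log₂ n ⌋ ^ 2 ≤ n * m ^ 4 → p ^ 2 * m ≤ q ^ 2 * n → IsCapacity n m p q cap →
    length ops ≤ m ^ a → WellFormed n (λ _ → false) ops →
    badCount (16 * suc (c + suc a)) 256 n p q cap m U ops * n ^ c ≤ m ^ U
  bound n (suc m′) p q _ U ops 1≤n _ 1≤q h≤ j²≤h (c₀ , refl , _ , cap-large) len≤ wf with (p ^ 2) ÷ (q ^ 2 * 256) Nat.≟ 0
  ... | yes e≡0 = from-snapshots a c n _ p q _ U ops wf (λ s P Q P≤n _ →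
    snapshot-bound-zero a c n _ p q _ U (n ^ c * suc (length ops)) e≡0 s P Q P≤n)
  ... | no  e≢0 = from-snapshots a c n _ p q _ U ops wf
    (snapshot-bound-pos a c n m′ p q c₀ U {{>-nonZero 1≤q}} {{≢-nonZero e≢0}} h≤ j²≤h cap-large (n ^ c * suc (length ops)) (begin
      n ^ c * suc (length ops)     ≤⟨ *-monoʳ-≤ (n ^ c) (+-mono-≤ (m^n>0 n {{>-nonZero 1≤n}} a) (≤-trans len≤ (^-monoˡ-≤ a m≤n′))) ⟩
      n ^ c * (n ^ a + n ^ a)      ≡⟨ cong (λ t → n ^ c * (n ^ a + t)) (sym (+-identityʳ (n ^ a))) ⟩
      n ^ c * (2 * n ^ a)          ≤⟨ *-monoʳ-≤ (n ^ c) (*-monoˡ-≤ (n ^ a) 2≤n′) ⟩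
      n ^ c * n ^ suc a            ≡⟨ sym (^-distribˡ-+-* n c (suc a)) ⟩
      n ^ (c + suc a)              ∎))
    where
    m≤n′ = m≤n a c n m′ p q c₀ U {{>-nonZero 1≤q}} {{≢-nonZero e≢0}} h≤ j²≤h cap-large
    2≤n′ = 2≤n a c n m′ p q c₀ U {{>-nonZero 1≤q}} {{≢-nonZero e≢0}} h≤ j²≤h cap-large
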